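{- Let $\mathcal F$ be a hypergraph whose edges are colored with $k$ colors $1,\dots,k$, and let $g:V(\mathcal F)\to\mathbb N$ be a simple function. Then there exists a simple $g$-detachment $\mathcal G$ of $\mathcal F$ (possibly with multiple edges), with amalgamation function $\Psi:V(\mathcal G)\to V(\mathcal F)$ whose number function is $g$, such that: (A1) $d_{\mathcal G}(v)\approx d_{\mathcal F}(u)/g(u)$ for each $u\in V(\mathcal F)$ and each $v\in\Psi^{ -1}(u)$; (A2) $d_{\mathcal G(j)}(v)\approx d_{\mathcal F(j)}(u)/g(u)$ for each $u\in V(\mathcal F)$, each $v\in\Psi^{ -1}(u)$ and each $1\le j\le k$; (A3) $m_{\mathcal G}(U_1,\dots,U_r)\approx m_{\mathcal F}(u_1^{m_1},\dots,u_r^{m_r})/\prod_{i=1}^r\binom{g(u_i)}{m_i}$ for all distinct $u_1,\dots,u_r\in V(\mathcal F)$ and all $U_i\subset\Psi^{ -1}(u_i)$ with $|U_i|=m_i\le g(u_i)$, $1\le i\le r$; (A4) $m_{\mathcal G(j)}(U_1,\dots,U_r)\approx m_{\mathcal F(j)}(u_1^{m_1},\dots,u_r^{m_r})/\prod_{i=1}^r\binom{g(u_i)}{m_i}$ for all distinct $u_1,\dots,u_r\in V(\mathcal F)$, all $U_i\subset\Psi^{ -1}(u_i)$ with $|U_i|=m_i\le g(u_i)$, $1\le i\le r$, and each $1\le j\le k$. (Here the edges of $\mathcal G$ are those of $\mathcal F$ and carry the same colors.)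
   Context: For real $x,y$, $x\approx y$ means $\lfloor y\rfloor\le x\le\lceil y\rceil$. A hypergraph $\mathcal G$ is a quintuple $(V,E,H,\psi,\phi)$ of disjoint finite sets $V$ (vertices), $E$ (edges), $H$ (hinges), a function $\psi:H\to V$ and a surjection $\phi:H\to E$; hinge $h$ attaches edge $\phi(h)$ to vertex $\psi(h)$. $H(v)=\psi^{ -1}(v)$, the degree is $d(v)=|H(v)|$, and $H(v,e)=\psi^{ -1}(v)\cap\phi^{ -1}(e)$. For a multiset $U$ of vertices with multiplicity function $\mu_U$, $E(U)$ is the set of edges $e$ with $|H(v,e)|=\mu_U(v)$ for every vertex $v$, and the multiplicity $m(U)=|E(U)|$. Notation: $m(u_1^{m_1},\dots,u_r^{m_r})$ is $m$ of the multiset containing $u_i$ with multiplicity $m_i$; $m(U_1,\dots,U_r)$ is $m$ of the multiset union of the sets $U_1,\dots,U_r$. A $k$-edge-coloring is a map $f:E\to\{1,\dots,k\}$, and $\mathcal G(j)$ is the sub-hypergraph formed by the edges of color $j$ (with their hinges); subscripts indicate the hypergraph in which notation is interpreted. If $\mathcal F=(V,E,H,\psi,\phi)$ and $\Psi:V\to W$ is onto, then $(W,E,H,\Psi\circ\psi,\phi)$ is an amalgamation of $\mathcal F$ and $\mathcal F$ is a detachment of it; the number function is $g(w)=|\Psi^{ -1}(w)|$, and $\mathcal F$ is then called a $g$-detachment. (In the theorem the roles are: $\mathcal F$ is the amalgamation of $\mathcal G$ via $\Psi$.) A function $g:V(\mathcal G)\to\mathbb N$ is simple if $|H(v,e)|\le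 g(v)$ for all vertices $v$ and edges $e$; a hypergraph is simple if the constant function $1$ is simple. -}

module Defs where

open import Data.Nat using (ℕ; zero; suc; _+_; _*_; _≤_; NonZero)
open import Data.Nat.Combinatorics using (_C_)
open import Data.Bool using (Bool; true; false; _∧_; if_then_else_)
open import Data.Fin using (Fin; zero; suc)
open import Data.Fin.Properties using (all?)
open import Data.Fin.Subset using (Subset; _∈_; ∣_∣)
open import Data.Fin.Subset.Properties using (_∈?_)
open import Data.Integer using (ℤ; +_) renaming (_≤_ to _≤ℤ_)
import Data.Rational as Q
open import Data.Product using (Σ; ∃; _×_; _,_)
open import Relation.Binary.PropositionalEquality using (_≡_)
open import Relation.Nullary.Decidable using (⌊_⌋)
import Data.Fin as F
import Data.Nat as N

sumFin : (n : ℕ) → (Fin n → ℕ) → ℕ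
sumFin zero    f = 0
sumFin (suc n) f = f zero + sumFin n (λ i → f (suc i))

prodFin : (n : ℕ) → (Fin n → ℕ) → ℕ
prodFin zero    f = 1
prodFin (suc n) f = f zero * prodFin n (λ i → f (suc i))

countFin : (n : ℕ) → (Fin n → Bool) → ℕ
countFin n P = sumFin n (λ i → if P i then 1 else 0)

_≈_/_ : ℕ → ℕ → (b : ℕ) → Set
x ≈ a / b = (nz : NonZero b) →
  (Q.floor (Q._/_ (+ a) b {{nz}}) ≤ℤ + x) × (+ x ≤ℤ Q.ceiling (Q._/_ (+ a) b {{nz}}))

-- Hypergraphs (V, E, H, ψ, φ) with V = Fin nV, E = Fin nE, H = Fin nH

record Hypergraph : Set where
  field
    nV nE nH : ℕ
    ψ     : Fin nH → Fin nV
    φ     : Fin nH → Fin nE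
    φ-onto : ∀ e → ∃ λ h → φ h ≡ e

open Hypergraph public

-- a set of edges (used for sub-hypergraphs 𝓖(j)); Bool-valued predicate
EdgeSet : Hypergraph → Set
EdgeSet 𝓖 = Fin (nE 𝓖) → Bool

allEdges : (𝓖 : Hypergraph) → EdgeSet 𝓖
allEdges 𝓖 e = true

colourClass : (𝓖 : Hypergraph) {k : ℕ} → (Fin (nE 𝓖) → Fin k) → Fin k → EdgeSet 𝓖
colourClass 𝓖 f j e = ⌊ f e F.≟ j ⌋

hingesAt : (𝓖 : Hypergraph) → Fin (nV 𝓖) → Fin (nE 𝓖) → ℕ
hingesAt 𝓖 v e = countFin (nH 𝓖) (λ h → ⌊ ψ 𝓖 h F.≟ v ⌋ ∧ ⌊ φ 𝓖 h F.≟ e ⌋)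

degIn : (𝓖 : Hypergraph) → EdgeSet 𝓖 → Fin (nV 𝓖) → ℕ
degIn 𝓖 S v = countFin (nH 𝓖) (λ h → ⌊ ψ 𝓖 h F.≟ v ⌋ ∧ S (φ 𝓖 h))

deg : (𝓖 : Hypergraph) → Fin (nV 𝓖) → ℕ
deg 𝓖 = degIn 𝓖 (allEdges 𝓖)

-- multiplicity m(U) of a multiset U (given by its multiplicity function μ)
-- in the sub-hypergraph formed by the edges in S:
-- number of edges e ∈ S with |H(v,e)| = μ(v) for every vertex v
multIn : (𝓖 : Hypergraph) → EdgeSet 𝓖 → (Fin (nV 𝓖) → ℕ) → ℕ
multIn 𝓖 S μ = countFin (nE 𝓖)
  (λ e → S e ∧ ⌊ all? (λ v → hingesAt 𝓖 v e N.≟ μ v) ⌋)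

mult : (𝓖 : Hypergraph) → (Fin (nV 𝓖) → ℕ) → ℕ
mult 𝓖 = multIn 𝓖 (allEdges 𝓖)

powMultiset : {n : ℕ} (r : ℕ) → (Fin r → Fin n) → (Fin r → ℕ) → Fin n → ℕ
powMultiset r u m v = sumFin r (λ i → if ⌊ u i F.≟ v ⌋ then m i else 0)

unionMultiset : {n : ℕ} (r : ℕ) → (Fin r → Subset n) → Fin n → ℕ
unionMultiset r U w = sumFin r (λ i → if ⌊ w ∈? U i ⌋ then 1 else 0)

SimpleFn : (𝓖 : Hypergraph) → (Fin (nV 𝓖) → ℕ) → Set
SimpleFn 𝓖 g = ∀ v e → hingesAt 𝓖 v e ≤ g v

SimpleHG : Hypergraph → Set
SimpleHG 𝓖 = SimpleFn 𝓖 (λ _ → 1)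

-- Detachments.  Given 𝓕 = (V,E,H,ψ,φ), a detachment is 𝓖 = (W,E,H,ψG,φ)
-- together with an onto Ψ : W → V with Ψ ∘ ψG = ψ (so 𝓕 is the
-- amalgamation of 𝓖 via Ψ).

detachment : (𝓕 : Hypergraph) (n : ℕ) → (Fin (nH 𝓕) → Fin n) → Hypergraph
detachment 𝓕 n ψG = record
  { nV = n ; nE = nE 𝓕 ; nH = nH 𝓕 ; ψ = ψG ; φ = φ 𝓕 ; φ-onto = φ-onto 𝓕 }

IsAmalgamationMap : (𝓕 : Hypergraph) {n : ℕ} → (Fin (nH 𝓕) → Fin n)
                  → (Fin n → Fin (nV 𝓕)) → Set
IsAmalgamationMap 𝓕 ψG Ψ =
  (∀ u → ∃ λ w → Ψ w ≡ u) × (∀ h → Ψ (ψG h) ≡ ψ 𝓕 h)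

numberFn : {n m : ℕ} → (Fin n → Fin m) → Fin m → ℕ
numberFn {n} Ψ u = countFin n (λ w → ⌊ Ψ w F.≟ u ⌋)

{-# OPTIONS --safe #-}
-- Nash-Williams' laminar-family method.  Vertices are split off one at a time:
-- to split a vertex α with g α = p into α and a new vertex β, one moves to β a
-- set A of hinges at α with ∣ A ∩ P ∣ ≈ ∣ P ∣ / p for all P in two laminar
-- families: all hinges at α, those of one colour, those of one edge; and those
-- on edges of one multiplicity type, or of one type and colour.  Since
-- (p C i) i = p ((p - 1) C (i - 1)) and (p C i) (p - i) = p ((p - 1) C i), the
-- quotients in (A1)-(A4) are preserved up to rounding, and rounding composes.
--
-- Such an A is a class of an equitable p-colouring of the hinges at α.  For two
-- colours, pair up the elements of each laminar family from its smallest sets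
-- upwards; the union of the two matchings is bipartite and a proper
-- 2-colouring of it bisects every set.  For p colours, bisect unions of two
-- unbalanced classes; this decreases the sum of the squared class sizes, so it
-- ends in an equitable colouring.
module Submission where

open import Defs
open import Algebra.Properties.CommutativeSemigroup using (interchange; x∙yz≈y∙xz)
open import Data.Bool using (Bool; true; false; _∧_; _∨_; not; if_then_else_; T?)
open import Data.Bool.Properties using (not-involutive; ∧-zeroʳ; ∧-identityʳ; ∧-assoc)
open import Data.Fin using (Fin; zero; suc; toℕ)
import Data.Fin as F
import Data.Fin.Properties as Fₚ
open import Data.Fin.Subset using (Subset; _∈_; ∣_∣; inside; outside)
open import Data.Fin.Subset.Properties using (_∈?_; drop-there)
import Data.Integer as ℤ
import Data.Integer.Properties as ℤₚ
open import Data.Integer.DivMod using ([n/d]*d≤n)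
import Data.Integer.GCD as ℤGCD
open import Data.Integer.Tactic.RingSolver using () renaming (solve-∀ to ℤ-solve-∀)
open import Data.List using (List; []; _∷_; _++_; filter; allFin; tabulate; cartesianProductWith)
open import Data.List.Membership.Propositional using (find) renaming (_∈_ to _∈ˡ_)
open import Data.List.Membership.Propositional.Properties using (∈-cartesianProductWith⁺)
open import Data.List.Properties using (++-assoc; ∷-injectiveˡ; ∷-injectiveʳ; tabulate-cong; ≡-dec)
open import Data.List.Relation.Binary.Permutation.Propositional using (_↭_; ↭-refl; ↭-sym; prep; swap; refl; trans)
open import Data.List.Relation.Binary.Permutation.Propositional.Properties using (shift; shifts; ++⁺ˡ; All-resp-↭; ∈-resp-↭)
open import Data.List.Relation.Unary.All as All using (All; []; _∷_)
import Data.List.Relation.Unary.All.Properties as Allₚ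
open import Data.List.Relation.Unary.AllPairs using (AllPairs; []; _∷_)
open import Data.List.Relation.Unary.Any using (here; there)
open import Data.List.Relation.Unary.Unique.Propositional using (Unique)
open import Data.List.Relation.Unary.Unique.Propositional.Properties using (filter⁺; allFin⁺)
open import Data.Maybe using (Maybe; just; nothing)
open import Data.Nat using (ℕ; zero; suc; _+_; _*_; _∸_; _≤_; _<_; z≤n; s≤s; _<?_; _≤?_; >-nonZero)
import Data.Nat as N
open import Data.Nat.Combinatorics using (_C_; nCk+nC[k+1]≡[n+1]C[k+1]; nC1≡n; k>n⇒nCk≡0)
open import Data.Nat.Properties
open import Data.Nat.Tactic.RingSolver using (solve-∀)
open import Data.Product using (Σ; ∃; _×_; _,_; proj₁; proj₂)
import Data.Rational as ℚ
import Data.Rational.Properties as ℚₚ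
open import Data.Sum using (_⊎_; inj₁; inj₂)
open import Data.Vec using ([]; _∷_; here; there)
open import Function using (case_of_)
open import Relation.Binary.Definitions using (DecidableEquality)
open import Relation.Binary.PropositionalEquality as ≡ using (_≡_; _≢_; cong; cong₂; sym; subst; subst₂; ≢-sym; _≗_)
open import Relation.Nullary using (Dec; yes; no; ¬_; contradiction)
open import Relation.Nullary.Decidable using (⌊_⌋)

-- Counting in lists, permutations and matchings.

𝟙 : Bool → ℕ
𝟙 b = if b then 1 else 0

⌊⌋-true : {P : Set} (P? : Dec P) → P → ⌊ P? ⌋ ≡ true
⌊⌋-true (yes _) _ = ≡.refl
⌊⌋-true (no ¬p) p = contradiction p ¬p

⌊⌋-false : {P : Set} (P? : Dec P) → ¬ P → ⌊ P? ⌋ ≡ false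
⌊⌋-false (yes p) ¬p = contradiction p ¬p
⌊⌋-false (no _) _ = ≡.refl

⌊⌋-cong : {P Q : Set} (P? : Dec P) (Q? : Dec Q) → (P → Q) → (Q → P) → ⌊ P? ⌋ ≡ ⌊ Q? ⌋
⌊⌋-cong (yes p) Q? to from = sym (⌊⌋-true Q? (to p))
⌊⌋-cong (no ¬p) Q? to from = sym (⌊⌋-false Q? (λ q → ¬p (from q)))

module _ {A : Set} where

  count : (A → Bool) → List A → ℕ
  count p []       = 0
  count p (x ∷ xs) = 𝟙 (p x) + count p xs

  count-↭ : (p : A → Bool) {xs ys : List A} → xs ↭ ys → count p xs ≡ count p ys
  count-↭ p refl = ≡.refl
  count-↭ p (prep x eq) = cong (𝟙 (p x) +_) (count-↭ p eq)
  count-↭ p (swap x y eq) rewrite count-↭ p eq =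
    x∙yz≈y∙xz +-commutativeSemigroup (𝟙 (p x)) (𝟙 (p y)) _
  count-↭ p (trans eq₁ eq₂) = ≡.trans (count-↭ p eq₁) (count-↭ p eq₂)

  count-++ : (p : A → Bool) (xs ys : List A) → count p (xs ++ ys) ≡ count p xs + count p ys
  count-++ p [] ys = ≡.refl
  count-++ p (x ∷ xs) ys rewrite count-++ p xs ys = sym (+-assoc (𝟙 (p x)) _ _)

  count-cong : {p q : A → Bool} → p ≗ q → (xs : List A) → count p xs ≡ count q xs
  count-cong eq [] = ≡.refl
  count-cong eq (x ∷ xs) = cong₂ _+_ (cong 𝟙 (eq x)) (count-cong eq xs)

  count-∧-≤ : (p q : A → Bool) (xs : List A) → count (λ x → p x ∧ q x) xs ≤ count p xs
  count-∧-≤ p q [] = z≤n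
  count-∧-≤ p q (x ∷ xs) with p x | q x
  ... | false | _     = count-∧-≤ p q xs
  ... | true  | true  = s≤s (count-∧-≤ p q xs)
  ... | true  | false = m≤n⇒m≤1+n (count-∧-≤ p q xs)

  extract : (p : A → Bool) (xs : List A) →
    (∃ λ x → ∃ λ xs′ → (xs ↭ x ∷ xs′) × (p x ≡ true)) ⊎ (count p xs ≡ 0)
  extract p [] = inj₂ ≡.refl
  extract p (x ∷ xs) with p x in px
  ... | true = inj₁ (x , xs , ↭-refl , px)
  ... | false with extract p xs
  ...   | inj₁ (y , xs′ , eq , py) = inj₁ (y , x ∷ xs′ , trans (prep x eq) (swap x y ↭-refl) , py)
  ...   | inj₂ none = inj₂ none

  Unique-resp-↭ : {xs ys : List A} → xs ↭ ys → Unique xs → Unique ys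
  Unique-resp-↭ refl u = u
  Unique-resp-↭ (prep x eq) (x∉ ∷ u) = All-resp-↭ eq x∉ ∷ Unique-resp-↭ eq u
  Unique-resp-↭ (swap x y eq) ((x≢y ∷ x∉) ∷ (y∉ ∷ u)) =
    (≢-sym x≢y ∷ All-resp-↭ eq y∉) ∷ (All-resp-↭ eq x∉ ∷ Unique-resp-↭ eq u)
  Unique-resp-↭ (trans eq₁ eq₂) u = Unique-resp-↭ eq₂ (Unique-resp-↭ eq₁ u)

  Unique-++⁻ˡ : (xs : List A) {ys : List A} → Unique (xs ++ ys) → Unique xs
  Unique-++⁻ˡ [] u = []
  Unique-++⁻ˡ (x ∷ xs) (x∉ ∷ u) = Allₚ.++⁻ˡ xs x∉ ∷ Unique-++⁻ˡ xs u

  -- A matching is a list of pairs; `Unique (ends L)` says that its pairs are disjoint and have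
  -- distinct members.
  ends : List (A × A) → List A
  ends [] = []
  ends ((x , y) ∷ L) = x ∷ y ∷ ends L

  ends-++ : (L M : List (A × A)) → ends (L ++ M) ≡ ends L ++ ends M
  ends-++ [] M = ≡.refl
  ends-++ ((x , y) ∷ L) M = cong (λ zs → x ∷ y ∷ zs) (ends-++ L M)

  Splits : (A → Bool) → List (A × A) → Set
  Splits c = All (λ (x , y) → c x ≡ not (c y))

-- Proper 2-colourings of the union of two matchings.

module TwoColouring {A : Set} (_≟_ : DecidableEquality A) where

  -- Hides the place of the pair in `L` and the order of its members: the returned implication
  -- rebuilds a splitting of `L` from one of `L′`, using that being of opposite colours is
  -- symmetric.
  extractPair : (x : A) (L : List (A × A)) →
    (∃ λ x′ → ∃ λ L′ → (ends L ↭ x ∷ x′ ∷ ends L′) ×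
       (∀ c → c x ≡ not (c x′) → Splits c L′ → Splits c L))
    ⊎ All (x ≢_) (ends L)
  extractPair x [] = inj₂ []
  extractPair x ((a , b) ∷ L) with x ≟ a
  ... | yes ≡.refl = inj₁ (b , L , ↭-refl , λ c e s → e ∷ s)
  ... | no x≢a with x ≟ b
  ...   | yes ≡.refl = inj₁ (a , L , swap a x ↭-refl ,
            λ c e s → ≡.trans (sym (not-involutive (c a))) (cong not (sym e)) ∷ s)
  ...   | no x≢b with extractPair x L
  ...     | inj₂ x∉ = inj₂ (x≢a ∷ x≢b ∷ x∉)
  ...     | inj₁ (x′ , L′ , eq , f) = inj₁ (x′ , (a , b) ∷ L′ ,
              trans (prep a (prep b eq)) (shifts (a ∷ b ∷ []) (x ∷ x′ ∷ [])) ,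
              λ { c e (s ∷ ss) → s ∷ f c e ss })

  recolour : A → A → Bool → (A → Bool) → A → Bool
  recolour x y v c z = if ⌊ x ≟ z ⌋ then v else (if ⌊ y ≟ z ⌋ then not v else c z)

  module _ {x y : A} {v : Bool} {c : A → Bool} where

    recolour-other : ∀ {z} → x ≢ z → y ≢ z → recolour x y v c z ≡ c z
    recolour-other {z} x≢z y≢z
      rewrite ⌊⌋-false (x ≟ z) x≢z | ⌊⌋-false (y ≟ z) y≢z = ≡.refl

    recolour-fst : recolour x y v c x ≡ v
    recolour-fst rewrite ⌊⌋-true (x ≟ x) ≡.refl = ≡.refl

    recolour-snd : x ≢ y → recolour x y v c y ≡ not v
    recolour-snd x≢y rewrite ⌊⌋-false (x ≟ y) x≢y | ⌊⌋-true (y ≟ y) ≡.refl = ≡.refl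

    recolour-splits : (L : List (A × A)) → All (x ≢_) (ends L) → All (y ≢_) (ends L) →
                      Splits c L → Splits (recolour x y v c) L
    recolour-splits [] _ _ _ = []
    recolour-splits ((a , b) ∷ L) (x≢a ∷ x≢b ∷ x∉) (y≢a ∷ y≢b ∷ y∉) (s ∷ ss)
      = (begin
          recolour x y v c a       ≡⟨ recolour-other x≢a y≢a ⟩
          c a                      ≡⟨ s ⟩
          not (c b)                ≡⟨ cong not (recolour-other x≢b y≢b) ⟨
          not (recolour x y v c b) ∎)
        ∷ recolour-splits L x∉ y∉ ss
      where open ≡.≡-Reasoning

    recolour-pair : x ≢ y → recolour x y v c x ≡ not (recolour x y v c y)
    recolour-pair x≢y = ≡.trans recolour-fst
      (≡.trans (sym (not-involutive v)) (cong not (sym (recolour-snd x≢y))))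

  splitOne : (L : List (A × A)) → Unique (ends L) → ∃ λ c → Splits c L
  splitOne [] _ = (λ _ → true) , []
  splitOne ((x , y) ∷ L) ((x≢y ∷ x∉) ∷ y∉ ∷ u) with splitOne L u
  ... | c , s = recolour x y true c , recolour-pair x≢y ∷ recolour-splits L x∉ y∉ s

  -- The pair (x , y) is contracted: the partners of x and y in the second
  -- matching become a pair of that matching.
  splitTwo : (L M : List (A × A)) → Unique (ends L) → Unique (ends M) →
             ∃ λ (c : A → Bool) → Splits c L × Splits c M
  splitTwo [] M _ uM with splitOne M uM
  ... | c , s = c , [] , s
  splitTwo ((x , y) ∷ L) M ((x≢y ∷ x∉L) ∷ y∉L ∷ uL) uM with extractPair x M
  ... | inj₂ x∉M with extractPair y M
  ...   | inj₂ y∉M with splitTwo L M uL uM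
  ...     | c , s , t = recolour x y true c ,
              recolour-pair x≢y ∷ recolour-splits L x∉L y∉L s , recolour-splits M x∉M y∉M t
  splitTwo ((x , y) ∷ L) M ((x≢y ∷ x∉L) ∷ y∉L ∷ uL) uM
      | inj₂ x∉M | inj₁ (y′ , M′ , eq , back)
    with Unique-resp-↭ eq uM | All-resp-↭ eq x∉M
  ... | (y≢y′ ∷ y∉M′) ∷ _ ∷ uM′ | _ ∷ x≢y′ ∷ x∉M′ with splitTwo L M′ uL uM′
  -- `x` has no partner in `M`, so its colour is free; the colour of `y′` makes `y` opposite to
  -- `y′`.
  ...   | c , s , t = recolour x y (c y′) c ,
            recolour-pair x≢y ∷ recolour-splits L x∉L y∉L s ,
            back _ (≡.trans (recolour-snd {c = c} x≢y) (cong not (sym (recolour-other {c = c} x≢y′ y≢y′))))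
              (recolour-splits M′ x∉M′ y∉M′ t)
  splitTwo ((x , y) ∷ L) M ((x≢y ∷ x∉L) ∷ y∉L ∷ uL) uM | inj₁ (x′ , M′ , eq , back)
    with Unique-resp-↭ eq uM
  ... | (x≢x′ ∷ x∉M′) ∷ x′∉M′ ∷ uM′ with y ≟ x′
  -- The pair lies in both matchings, and giving its members opposite colours serves both.
  ...   | yes ≡.refl with splitTwo L M′ uL uM′
  ...     | c , s , t = recolour x y true c ,
              recolour-pair x≢y ∷ recolour-splits L x∉L y∉L s ,
              back _ (recolour-pair x≢y) (recolour-splits M′ x∉M′ x′∉M′ t)
  splitTwo ((x , y) ∷ L) M ((x≢y ∷ x∉L) ∷ y∉L ∷ uL) uM | inj₁ (x′ , M′ , eq , back)
      | (x≢x′ ∷ x∉M′) ∷ x′∉M′ ∷ uM′ | no y≢x′ with extractPair y M′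
  ... | inj₂ y∉M′ with splitTwo L M′ uL uM′
  ...   | c , s , t = recolour x y (not (c x′)) c ,
            recolour-pair x≢y ∷ recolour-splits L x∉L y∉L s ,
            back _ (≡.trans (recolour-fst {c = c}) (cong not (sym (recolour-other {c = c} x≢x′ y≢x′))))
              (recolour-splits M′ x∉M′ y∉M′ t)
  splitTwo ((x , y) ∷ L) M ((x≢y ∷ x∉L) ∷ y∉L ∷ uL) uM | inj₁ (x′ , M′ , eq , back)
      | (x≢x′ ∷ x∉M′) ∷ x′∉M′ ∷ uM′ | no y≢x′ | inj₁ (y′ , M″ , eq′ , back′)
    with Unique-resp-↭ eq′ uM′ | All-resp-↭ eq′ x∉M′ | All-resp-↭ eq′ x′∉M′
  ... | (y≢y′ ∷ y∉M″) ∷ y′∉M″ ∷ uM″ | _ ∷ x≢y′ ∷ x∉M″ | _ ∷ x′≢y′ ∷ x′∉M″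
    -- The path x′, x, y, y′ is replaced by the edge x′y′, and a colouring that separates `x′` from
    -- `y′` alternates along the path. The recursion is on `L`, so the second matching may gain this
    -- pair.
    with splitTwo L ((x′ , y′) ∷ M″) uL ((x′≢y′ ∷ x′∉M″) ∷ y′∉M″ ∷ uM″)
  ... | c , s , e ∷ t = recolour x y (not (c x′)) c ,
          recolour-pair x≢y ∷ recolour-splits L x∉L y∉L s ,
          back _ (≡.trans (recolour-fst {c = c}) (cong not (sym (recolour-other {c = c} x≢x′ y≢x′))))
            (back′ _ (begin
                recolour x y (not (c x′)) c y        ≡⟨ recolour-snd {c = c} x≢y ⟩
                not (not (c x′))                     ≡⟨ not-involutive (c x′) ⟩
                c x′                                 ≡⟨ e ⟩
                not (c y′)                           ≡⟨ cong not (recolour-other {c = c} x≢y′ y≢y′) ⟨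
                not (recolour x y (not (c x′)) c y′) ∎)
              (recolour-splits M″ x∉M″ y∉M″ t))
    where open ≡.≡-Reasoning

-- Bisecting the sets of two laminar families.

Close : ℕ → ℕ → Set
Close a b = (a ≤ suc b) × (b ≤ suc a)

module _ {A : Set} where

  Bisects : (A → Bool) → (A → Bool) → List A → Set
  Bisects c q X = Close (count (λ x → q x ∧ c x) X) (count (λ x → q x ∧ not (c x)) X)

module Laminar {A B : Set} (_≟_ : DecidableEquality A) (_≟ᴮ_ : DecidableEquality B) where
  open TwoColouring _≟_

  inClass : (A → B) → B → A → Bool
  inClass ℓ b x = ⌊ ℓ x ≟ᴮ b ⌋

  -- A laminar family is encoded as a chain of labellings from fine to coarse: its sets are the
  -- label classes, and refinement makes them nested.
  Refines : (A → B) → (A → B) → Set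
  Refines ℓ ℓ′ = ∀ x y → ℓ x ≡ ℓ y → ℓ′ x ≡ ℓ′ y

  -- Greedy pairing: a new element takes an unpaired partner of its own label if there is one, so
  -- each label keeps at most one unpaired element.
  pairUp : (ℓ : A → B) (X : List A) → ∃ λ L → ∃ λ Z →
    (X ↭ ends L ++ Z) × All (λ (x , y) → ℓ x ≡ ℓ y) L × (∀ b → count (inClass ℓ b) Z ≤ 1)
  pairUp ℓ [] = [] , [] , ↭-refl , [] , λ _ → z≤n
  pairUp ℓ (x ∷ X) with pairUp ℓ X
  ... | L , Z , eq , same , few with extract (inClass ℓ (ℓ x)) Z
  ...   | inj₁ (z , Z′ , eqZ , z∼x) =
            (x , z) ∷ L , Z′ ,
            prep x (trans eq (trans (++⁺ˡ (ends L) eqZ) (shift z (ends L) Z′))) ,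
            related (ℓ z ≟ᴮ ℓ x) z∼x ∷ same ,
            λ b → ≤-trans (m≤n+m _ (𝟙 (inClass ℓ b z)))
                    (subst (_≤ 1) (count-↭ (inClass ℓ b) eqZ) (few b))
    where
    related : (d : Dec (ℓ z ≡ ℓ x)) → ⌊ d ⌋ ≡ true → ℓ x ≡ ℓ z
    related (yes p) _ = sym p
  ...   | inj₂ none = L , x ∷ Z , trans (prep x eq) (↭-sym (shift x (ends L) Z)) , same , few′
    where
    few′ : ∀ b → count (inClass ℓ b) (x ∷ Z) ≤ 1
    few′ b with ℓ x ≟ᴮ b
    ... | no _ = few b
    ... | yes ≡.refl rewrite none = s≤s z≤n

  module _ (c : A → Bool) (ℓ : A → B) (b : B) where

    Bisects-↭ : ∀ {X Y} → X ↭ Y → Bisects c (inClass ℓ b) Y → Bisects c (inClass ℓ b) X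
    Bisects-↭ eq = subst₂ Close (sym (count-↭ _ eq)) (sym (count-↭ _ eq))

    ends-even : ∀ L → All (λ (x , y) → ℓ x ≡ ℓ y) L → Splits c L →
      count (λ x → inClass ℓ b x ∧ c x) (ends L) ≡ count (λ x → inClass ℓ b x ∧ not (c x)) (ends L)
    ends-even [] _ _ = ≡.refl
    ends-even ((x , y) ∷ L) (e ∷ es) (s ∷ ss)
      rewrite e | s | ends-even L es ss with inClass ℓ b y | c y
    ... | true  | true  = ≡.refl
    ... | true  | false = ≡.refl
    ... | false | _     = ≡.refl

    Bisects-++ : ∀ L {Z} → All (λ (x , y) → ℓ x ≡ ℓ y) L → Splits c L →
      Bisects c (inClass ℓ b) Z → Bisects c (inClass ℓ b) (ends L ++ Z)
    Bisects-++ L {Z} es ss (p , q)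
      rewrite count-++ (λ x → inClass ℓ b x ∧ c x) (ends L) Z
            | count-++ (λ x → inClass ℓ b x ∧ not (c x)) (ends L) Z
            | ends-even L es ss
      = add p , add q
      where
      m = count (λ x → inClass ℓ b x ∧ not (c x)) (ends L)
      add : ∀ {s t} → s ≤ suc t → m + s ≤ suc (m + t)
      add {s} {t} s≤ = ≤-trans (+-monoʳ-≤ m s≤) (≤-reflexive (+-suc m t))

  -- The elements left over by the finest labelling are paired by the coarser ones. A pair made
  -- early lies inside one class of every later labelling and so adds one to each side; what is left
  -- of a class after its own labelling has paired is at most one element before later pairs are
  -- even considered.
  bisecting : (ℓs : List (A → B)) → AllPairs Refines ℓs → (X : List A) →
    ∃ λ L → ∃ λ Z → (X ↭ ends L ++ Z) ×
      (∀ c → Splits c L → All (λ ℓ → ∀ b → Bisects c (inClass ℓ b) X) ℓs)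
  bisecting [] _ X = [] , X , ↭-refl , λ _ _ → []
  bisecting (ℓ ∷ ℓs) (refines ∷ chain) X with pairUp ℓ X
  ... | L , Z , eq , same , few with bisecting ℓs chain Z
  ...   | M , Z′ , eq′ , bis = L ++ M , Z′ ,
          trans eq (subst (ends L ++ Z ↭_)
            (≡.trans (sym (++-assoc (ends L) (ends M) Z′)) (cong (_++ Z′) (sym (ends-++ L M))))
            (++⁺ˡ (ends L) eq′)) ,
          λ c s → let sL = Allₚ.++⁻ˡ L s ; sM = Allₚ.++⁻ʳ L s in
            (λ b → Bisects-↭ c ℓ b eq (Bisects-++ c ℓ b L same sL (atMostOne c b)))
            ∷ All.zipWith (λ {ℓ′} (r , bs) b →
                Bisects-↭ c ℓ′ b eq (Bisects-++ c ℓ′ b L (All.map (r _ _) same) sL (bs b)))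
                (refines , bis c sM)
    where
    atMostOne : ∀ c b → Bisects c (inClass ℓ b) Z
    atMostOne c b = small c , small (λ x → not (c x))
      where
      small : ∀ d {m} → count (λ x → inClass ℓ b x ∧ d x) Z ≤ suc m
      small d = ≤-trans (count-∧-≤ (inClass ℓ b) d Z) (≤-trans (few b) (s≤s z≤n))

  bisection : (ℓs ms : List (A → B)) → AllPairs Refines ℓs → AllPairs Refines ms →
    (X : List A) → Unique X →
    ∃ λ c → All (λ ℓ → ∀ b → Bisects c (inClass ℓ b) X) (ℓs ++ ms)
  bisection ℓs ms chainℓ chainm X uX with bisecting ℓs chainℓ X | bisecting ms chainm X
  ... | L , _ , eqL , bisL | M , _ , eqM , bisM
    with splitTwo L M (Unique-++⁻ˡ (ends L) (Unique-resp-↭ eqL uX))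
                      (Unique-++⁻ˡ (ends M) (Unique-resp-↭ eqM uX))
  ... | c , sL , sM = c , Allₚ.++⁺ (bisL c sL) (bisM c sM)

-- Finite sums.

sumFin-cong : ∀ n {f g : Fin n → ℕ} → f ≗ g → sumFin n f ≡ sumFin n g
sumFin-cong zero eq = ≡.refl
sumFin-cong (suc n) eq = cong₂ _+_ (eq zero) (sumFin-cong n (λ i → eq (suc i)))

sumFin-mono : ∀ n {f g : Fin n → ℕ} → (∀ i → f i ≤ g i) → sumFin n f ≤ sumFin n g
sumFin-mono zero le = z≤n
sumFin-mono (suc n) le = +-mono-≤ (le zero) (sumFin-mono n (λ i → le (suc i)))

sumFin-const : ∀ n c → sumFin n (λ _ → c) ≡ n * c
sumFin-const zero c = ≡.refl
sumFin-const (suc n) c = cong (c +_) (sumFin-const n c)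

sumFin-zero : ∀ n {f : Fin n → ℕ} → (∀ i → f i ≡ 0) → sumFin n f ≡ 0
sumFin-zero n eq = ≡.trans (sumFin-cong n eq) (≡.trans (sumFin-const n 0) (*-zeroʳ n))

sumFin-+ : ∀ n (f g : Fin n → ℕ) → sumFin n (λ i → f i + g i) ≡ sumFin n f + sumFin n g
sumFin-+ zero f g = ≡.refl
sumFin-+ (suc n) f g rewrite sumFin-+ n (λ i → f (suc i)) (λ i → g (suc i)) =
  interchange +-commutativeSemigroup (f zero) (g zero) _ _

sumFin-swap : ∀ m n (f : Fin m → Fin n → ℕ) →
  sumFin m (λ i → sumFin n (f i)) ≡ sumFin n (λ j → sumFin m (λ i → f i j))
sumFin-swap zero n f = sym (sumFin-zero n (λ _ → ≡.refl))
sumFin-swap (suc m) n f = ≡.trans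
  (cong (sumFin n (f zero) +_) (sumFin-swap m n (λ i → f (suc i))))
  (sym (sumFin-+ n (f zero) _))

⌊⌋-suc : ∀ {n} (k i : Fin n) → ⌊ suc k F.≟ suc i ⌋ ≡ ⌊ k F.≟ i ⌋
⌊⌋-suc k i = ⌊⌋-cong (suc k F.≟ suc i) (k F.≟ i) Fₚ.suc-injective (cong suc)

sumFin-remove : ∀ n (f : Fin n → ℕ) (i : Fin n) →
  sumFin n f ≡ f i + sumFin n (λ k → if ⌊ k F.≟ i ⌋ then 0 else f k)
sumFin-remove (suc n) f zero = ≡.refl
sumFin-remove (suc n) f (suc i) = begin
  f zero + sumFin n (λ k → f (suc k))
    ≡⟨ cong (f zero +_) (sumFin-remove n (λ k → f (suc k)) i) ⟩
  f zero + (f (suc i) + sumFin n (λ k → if ⌊ k F.≟ i ⌋ then 0 else f (suc k)))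
    ≡⟨ x∙yz≈y∙xz +-commutativeSemigroup (f zero) (f (suc i)) _ ⟩
  f (suc i) + (f zero + sumFin n (λ k → if ⌊ k F.≟ i ⌋ then 0 else f (suc k)))
    ≡⟨ cong (λ s → f (suc i) + (f zero + s)) (sumFin-cong n
         (λ k → cong (λ b → if b then 0 else f (suc k)) (sym (⌊⌋-suc k i)))) ⟩
  f (suc i) + (f zero + sumFin n (λ k → if ⌊ suc k F.≟ suc i ⌋ then 0 else f (suc k))) ∎
  where open ≡.≡-Reasoning

sumFin-single : ∀ n (f : Fin n → ℕ) (i : Fin n) →
  sumFin n (λ k → if ⌊ k F.≟ i ⌋ then f k else 0) ≡ f i
sumFin-single n f i = ≡.trans (sumFin-remove n _ i) (≡.trans
  (cong₂ _+_ (cong (λ b → if b then f i else 0) (⌊⌋-true (i F.≟ i) ≡.refl))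
             (sumFin-zero n (λ k → vanish ⌊ k F.≟ i ⌋ (f k))))
  (+-identityʳ _))
  where
  vanish : ∀ b x → (if b then 0 else (if b then x else 0)) ≡ 0
  vanish true _ = ≡.refl
  vanish false _ = ≡.refl

-- x ≈ a / b without division: a / b < x + 1 and x - 1 < a / b.
record Near (x a b : ℕ) : Set where
  constructor bounds
  field
    above : a < suc x * b
    below : x * b < a + b

-- Balancing two numbers lowers the sum of their squares.

-- Since `a′` and `b′` are balanced with the same sum, `a ≤ a′`. With `a′ = a + t` and `b = t + b′`
-- the two sums of squares differ by 2t(b′ - a).
squares-decrease-≤-≤ : ∀ {a b a′ b′} → a + b ≡ a′ + b′ → a ≤ b → a′ ≤ b′ → b′ ≤ suc a′ →
  (a′ * a′ + b′ * b′ ≤ a * a + b * b) × (suc a < b → a′ * a′ + b′ * b′ < a * a + b * b)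
squares-decrease-≤-≤ {a} {b} {a′} {b′} sum a≤b a′≤b′ b′≤ = go (m≤n⇒∃[o]m+o≡n a≤a′)
  where
  a≤a′ : a ≤ a′
  a≤a′ = ≮⇒≥ λ a′<a → <-irrefl (sym sum) (≤-<-trans
    (+-monoʳ-≤ a′ b′≤) (+-mono-<-≤ a′<a (≤-trans a′<a a≤b)))
  go : (∃ λ t → a + t ≡ a′) → (a′ * a′ + b′ * b′ ≤ a * a + b * b) ×
         (suc a < b → a′ * a′ + b′ * b′ < a * a + b * b)
  go (t , ≡.refl) = weak , strict
    where
    b≡ : b ≡ t + b′
    b≡ = +-cancelˡ-≡ a _ _ (≡.trans sum (+-assoc a t b′))
    lhs : (a + t) * (a + t) + b′ * b′ ≡ a * a + (b′ * b′ + t * t) + 2 * (t * a)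
    lhs = identity a t b′
      where
      identity : ∀ a t b → (a + t) * (a + t) + b * b ≡ a * a + (b * b + t * t) + 2 * (t * a)
      identity = solve-∀
    rhs : a * a + b * b ≡ a * a + (b′ * b′ + t * t) + 2 * (t * b′)
    rhs rewrite b≡ = identity a t b′
      where
      identity : ∀ a t b → a * a + (t + b) * (t + b) ≡ a * a + (b * b + t * t) + 2 * (t * b)
      identity = solve-∀
    weak : (a + t) * (a + t) + b′ * b′ ≤ a * a + b * b
    weak rewrite lhs | rhs = +-monoʳ-≤ (a * a + (b′ * b′ + t * t)) (*-monoʳ-≤ 2 (*-monoʳ-≤ t (m+n≤o⇒m≤o a a′≤b′)))
    strict : suc a < b → (a + t) * (a + t) + b′ * b′ < a * a + b * b
    strict 1+a<b rewrite lhs | rhs =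
      +-monoʳ-< (a * a + (b′ * b′ + t * t)) (*-monoʳ-< 2 (*-monoʳ-< t {{>-nonZero t>0}} (<-≤-trans (m<m+n a t>0) a′≤b′)))
      where
      -- For `t = 0` nothing has changed, and `b = b′ ≤ suc a` contradicts the gap between `a` and
      -- `b`.
      t>0 : 0 < t
      t>0 = n≢0⇒n>0 λ { ≡.refl → 1+n≰n (≤-trans 1+a<b (≤-trans (≤-reflexive b≡)
              (≤-trans b′≤ (s≤s (≤-reflexive (+-identityʳ a)))))) }

squares-decrease-≤ : ∀ {a b a′ b′} → a + b ≡ a′ + b′ → a ≤ b → Close a′ b′ →
  (a′ * a′ + b′ * b′ ≤ a * a + b * b) × (suc a < b → a′ * a′ + b′ * b′ < a * a + b * b)
squares-decrease-≤ {a} {b} {a′} {b′} sum a≤b (p , q) with ≤-total a′ b′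
... | inj₁ a′≤b′ = squares-decrease-≤-≤ sum a≤b a′≤b′ q
... | inj₂ b′≤a′ rewrite +-comm (a′ * a′) (b′ * b′) =
  squares-decrease-≤-≤ (≡.trans sum (+-comm a′ b′)) a≤b b′≤a′ p

squares-decrease : ∀ {a b a′ b′} → a + b ≡ a′ + b′ → Close a′ b′ →
  (a′ * a′ + b′ * b′ ≤ a * a + b * b) × (suc b < a → a′ * a′ + b′ * b′ < a * a + b * b)
squares-decrease {a} {b} {a′} {b′} sum close with ≤-total a b
... | inj₁ a≤b = proj₁ (squares-decrease-≤ {a} sum a≤b close) ,
        λ b<a → contradiction (≤-trans b<a a≤b) (λ le → 1+n≰n (≤-trans (n≤1+n _) le))
... | inj₂ b≤a rewrite +-comm (a * a) (b * b) =
        squares-decrease-≤ {b} (≡.trans (+-comm b a) sum) b≤a close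

-- Equitable colourings.

count-+ : {A : Set} (p q r : A → Bool) (X : List A) → (∀ x → 𝟙 (p x) ≡ 𝟙 (q x) + 𝟙 (r x)) →
  count p X ≡ count q X + count r X
count-+ p q r [] eq = ≡.refl
count-+ p q r (x ∷ X) eq rewrite eq x | count-+ p q r X eq =
  interchange +-commutativeSemigroup (𝟙 (q x)) (𝟙 (r x)) _ _

count-fibres : {A : Set} {n : ℕ} (c : A → Fin n) (q : A → Bool) (X : List A) →
  sumFin n (λ k → count (λ x → q x ∧ ⌊ c x F.≟ k ⌋) X) ≡ count q X
count-fibres {n = n} c q [] = sumFin-zero n (λ _ → ≡.refl)
count-fibres {n = n} c q (x ∷ X) = ≡.trans (sumFin-+ n _ _)
  (cong₂ _+_ fibre (count-fibres c q X))
  where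
  fibre : sumFin n (λ k → 𝟙 (q x ∧ ⌊ c x F.≟ k ⌋)) ≡ 𝟙 (q x)
  fibre with q x
  ... | false = sumFin-zero n (λ _ → ≡.refl)
  ... | true = ≡.trans (sumFin-cong n (λ k → cong 𝟙
                 (⌊⌋-cong (c x F.≟ k) (k F.≟ c x) sym sym))) (sumFin-single n (λ _ → 1) (c x))

count-filter : {A : Set} (s q : A → Bool) (X : List A) →
  count q (filter (λ x → T? (s x)) X) ≡ count (λ x → s x ∧ q x) X
count-filter s q [] = ≡.refl
count-filter s q (x ∷ X) with s x
... | true  = cong (𝟙 (q x) +_) (count-filter s q X)
... | false = count-filter s q X

module Equitable {A : Set} (X : List A) {n : ℕ} where

  size : (A → Fin n) → (A → Bool) → Fin n → ℕ
  size c q k = count (λ x → q x ∧ ⌊ c x F.≟ k ⌋) X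

  energy : (A → Fin n) → (A → Bool) → ℕ
  energy c q = sumFin n (λ k → size c q k * size c q k)

  totalEnergy : (A → Fin n) → List (A → Bool) → ℕ
  totalEnergy c []       = 0
  totalEnergy c (q ∷ qs) = energy c q + totalEnergy c qs

  Equitable : (A → Fin n) → (A → Bool) → Set
  Equitable c q = ∀ i j → size c q i ≤ suc (size c q j)

  module _ (c : A → Fin n) {i j : Fin n} (i≢j : i ≢ j) where

    either : A → Bool
    either x = ⌊ c x F.≟ i ⌋ ∨ ⌊ c x F.≟ j ⌋

    recombine : (A → Bool) → A → Fin n
    recombine d x = if either x then (if d x then i else j) else c x

    private
      either-split : (q : A → Bool) (x : A) → 𝟙 (either x ∧ q x) ≡ 𝟙 (q x ∧ ⌊ c x F.≟ i ⌋) + 𝟙 (q x ∧ ⌊ c x F.≟ j ⌋)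
      either-split q x with q x | c x F.≟ i | c x F.≟ j
      ... | true  | yes p | yes p′ = contradiction (≡.trans (sym p) p′) i≢j
      ... | true  | yes _ | no _  = ≡.refl
      ... | true  | no _  | yes _ = ≡.refl
      ... | true  | no _  | no _  = ≡.refl
      ... | false | yes _ | yes _ = ≡.refl
      ... | false | yes _ | no _  = ≡.refl
      ... | false | no _  | yes _ = ≡.refl
      ... | false | no _  | no _  = ≡.refl

      recombine-i : (d q : A → Bool) (x : A) → (q x ∧ ⌊ recombine d x F.≟ i ⌋) ≡ ((either x ∧ q x) ∧ d x)
      recombine-i d q x with c x F.≟ i | c x F.≟ j | d x
      ... | yes _ | _     | true  rewrite ⌊⌋-true (i F.≟ i) ≡.refl = ≡.refl
      ... | yes _ | _     | false rewrite ⌊⌋-false (j F.≟ i) (≢-sym i≢j) = ≡.refl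
      ... | no _  | yes _ | true  rewrite ⌊⌋-true (i F.≟ i) ≡.refl = ≡.refl
      ... | no _  | yes _ | false rewrite ⌊⌋-false (j F.≟ i) (≢-sym i≢j) = ≡.refl
      ... | no p  | no _  | _     rewrite ⌊⌋-false (c x F.≟ i) p = ∧-zeroʳ (q x)

      recombine-j : (d q : A → Bool) (x : A) → (q x ∧ ⌊ recombine d x F.≟ j ⌋) ≡ ((either x ∧ q x) ∧ not (d x))
      recombine-j d q x with c x F.≟ i | c x F.≟ j | d x
      ... | yes _ | _     | false rewrite ⌊⌋-true (j F.≟ j) ≡.refl = ≡.refl
      ... | yes _ | _     | true  rewrite ⌊⌋-false (i F.≟ j) i≢j = ≡.refl
      ... | no _  | yes _ | false rewrite ⌊⌋-true (j F.≟ j) ≡.refl = ≡.refl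
      ... | no _  | yes _ | true  rewrite ⌊⌋-false (i F.≟ j) i≢j = ≡.refl
      ... | no _  | no p  | _     rewrite ⌊⌋-false (c x F.≟ j) p = ∧-zeroʳ (q x)

      recombine-other : (d q : A → Bool) {k : Fin n} → k ≢ i → k ≢ j → ∀ x →
        (q x ∧ ⌊ recombine d x F.≟ k ⌋) ≡ (q x ∧ ⌊ c x F.≟ k ⌋)
      recombine-other d q {k} k≢i k≢j x with c x F.≟ i | c x F.≟ j | d x
      ... | yes p | _     | true  rewrite p = ≡.refl
      ... | yes p | _     | false rewrite p | ⌊⌋-false (j F.≟ k) (≢-sym k≢j) | ⌊⌋-false (i F.≟ k) (≢-sym k≢i) = ≡.refl
      ... | no _  | yes p | true  rewrite p | ⌊⌋-false (j F.≟ k) (≢-sym k≢j) | ⌊⌋-false (i F.≟ k) (≢-sym k≢i) = ≡.refl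
      ... | no _  | yes p | false rewrite p = ≡.refl
      ... | no _  | no _  | _ = ≡.refl

      split-either : (d q : A → Bool) (x : A) → 𝟙 (either x ∧ q x) ≡ 𝟙 ((either x ∧ q x) ∧ d x) + 𝟙 ((either x ∧ q x) ∧ not (d x))
      split-either d q x with either x ∧ q x | d x
      ... | true  | true  = ≡.refl
      ... | true  | false = ≡.refl
      ... | false | _     = ≡.refl

      rest : (A → Fin n) → (A → Bool) → ℕ
      rest c′ q = sumFin n (λ k → if ⌊ k F.≟ j ⌋ then 0 else
        (if ⌊ k F.≟ i ⌋ then 0 else size c′ q k * size c′ q k))

      energy-split : (c′ : A → Fin n) (q : A → Bool) → energy c′ q ≡
        (size c′ q i * size c′ q i + size c′ q j * size c′ q j) + rest c′ q
      energy-split c′ q = ≡.trans (sumFin-remove n _ i) (≡.trans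
        (cong (size c′ q i * size c′ q i +_) (≡.trans (sumFin-remove n _ j)
          (cong (λ b → (if b then 0 else size c′ q j * size c′ q j) + rest c′ q) (⌊⌋-false (j F.≟ i) (≢-sym i≢j)))))
        (sym (+-assoc (size c′ q i * size c′ q i) _ _)))

    -- Only the classes `i` and `j` change, with the same total inside `q`, and `d` leaves them at
    -- most one apart; so the comparison of two squares decides the change of the whole energy.
    recombine-energy : (d q : A → Bool) → Bisects d (λ x → either x ∧ q x) X →
      let c′ = recombine d in
      (energy c′ q ≤ energy c q) × (suc (size c q j) < size c q i → energy c′ q < energy c q)
    recombine-energy d q close =
      subst₂ _≤_ after before (+-monoˡ-≤ (rest c q) (proj₁ dec)) ,
      λ lt → subst₂ _<_ after before (+-monoˡ-< (rest c q) (proj₂ dec lt))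
      where
      c′ = recombine d
      rest-same : rest (recombine d) q ≡ rest c q
      rest-same = sumFin-cong n same
        where
        same : ∀ k → (if ⌊ k F.≟ j ⌋ then 0 else (if ⌊ k F.≟ i ⌋ then 0 else size c′ q k * size c′ q k))
             ≡ (if ⌊ k F.≟ j ⌋ then 0 else (if ⌊ k F.≟ i ⌋ then 0 else size c q k * size c q k))
        same k with k F.≟ j | k F.≟ i
        ... | yes _ | _     = ≡.refl
        ... | no _  | yes _ = ≡.refl
        ... | no k≢j | no k≢i = cong (λ s → s * s) (count-cong (recombine-other d q k≢i k≢j) X)
      sizeᵢ : size c′ q i ≡ count (λ x → (either x ∧ q x) ∧ d x) X
      sizeᵢ = count-cong (recombine-i d q) X
      sizeⱼ : size c′ q j ≡ count (λ x → (either x ∧ q x) ∧ not (d x)) X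
      sizeⱼ = count-cong (recombine-j d q) X
      before = sym (energy-split c q)
      after = ≡.trans (cong (size c′ q i * size c′ q i + size c′ q j * size c′ q j +_) (sym rest-same))
                (sym (energy-split c′ q))
      dec = squares-decrease {size c q i} {size c q j} {size c′ q i} {size c′ q j}
        (≡.trans (sym (count-+ _ _ _ X (either-split q)))
          (≡.trans (count-+ _ _ _ X (split-either d q)) (sym (cong₂ _+_ sizeᵢ sizeⱼ))))
        (subst₂ Close (sym sizeᵢ) (sym sizeⱼ) close)

  totalEnergy-≤ : ∀ {c c′ qs} → All (λ q → energy c′ q ≤ energy c q) qs →
    totalEnergy c′ qs ≤ totalEnergy c qs
  totalEnergy-≤ [] = z≤n
  totalEnergy-≤ (le ∷ les) = +-mono-≤ le (totalEnergy-≤ les)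

  totalEnergy-< : ∀ {c c′ qs q} → All (λ q → energy c′ q ≤ energy c q) qs →
    q ∈ˡ qs → energy c′ q < energy c q → totalEnergy c′ qs < totalEnergy c qs
  totalEnergy-< (le ∷ les) (here ≡.refl) lt = +-mono-<-≤ lt (totalEnergy-≤ les)
  totalEnergy-< (le ∷ les) (there q∈) lt = +-mono-≤-< le (totalEnergy-< les q∈ lt)

  Unfair : (A → Fin n) → (A → Bool) → Set
  Unfair c q = ∃ λ i → ∃ λ j → suc (size c q j) < size c q i

  fair? : ∀ c q → Equitable c q ⊎ Unfair c q
  fair? c q with Fₚ.any? (λ i → Fₚ.any? (λ j → suc (size c q j) <? size c q i))
  ... | yes bad = inj₂ bad
  ... | no good = inj₁ (λ i j → ≮⇒≥ (λ lt → good (i , j , lt)))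

  -- While some set is unbalanced between colours `i` and `j`, the elements of these two colours are
  -- redistributed by a bisection that serves all sets of `qs` at once. No set gains energy and the
  -- unbalanced one loses some.
  equitable : (qs : List (A → Bool)) →
    (∀ s → ∃ λ d → All (λ q → Bisects d (λ x → s x ∧ q x) X) qs) →
    (A → Fin n) → ∃ λ c → All (Equitable c) qs
  -- The fuel stays above the total energy, so it cannot run out.
  equitable qs bisect c₀ = go (suc (totalEnergy c₀ qs)) c₀ ≤-refl
    where
    go : ∀ fuel c → totalEnergy c qs < fuel → ∃ λ c → All (Equitable c) qs
    go (suc fuel) c (s≤s le) with All.decide (fair? c) qs
    ... | inj₁ good = c , good
    ... | inj₂ bad with find bad
    ...   | q , q∈ , i , j , lt = go fuel (recombine c i≢j d)
              (<-≤-trans (totalEnergy-< (All.map proj₁ steps) q∈ (proj₂ (All.lookup steps q∈) lt)) le)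
      where
      i≢j : i ≢ j
      i≢j ≡.refl = 1+n≰n (≤-trans (n≤1+n _) lt)
      d = proj₁ (bisect (either c i≢j))
      steps : All (λ q → (energy (recombine c i≢j d) q ≤ energy c q) ×
                         (suc (size c q j) < size c q i → energy (recombine c i≢j d) q < energy c q)) qs
      steps = All.map (λ {q} → recombine-energy c i≢j d q) (proj₂ (bisect (either c i≢j)))

  -- Every class size is at most `suc (s i)`, and that of `i` itself is strictly smaller, so summing
  -- over the `n` colours gives a strict bound; the lower bound is symmetric.
  equitable-Near : ∀ {c q} → Equitable c q → ∀ i → Near (size c q i) (count q X) n
  equitable-Near {c} {q} eq i = bounds upper lower
    where
    open ≤-Reasoning
    s = size c q
    upper : count q X < suc (s i) * n
    upper = begin-strict
      count q X                      ≡⟨ count-fibres c q X ⟨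
      sumFin n s                     ≡⟨ sumFin-remove n s i ⟩
      s i + sumFin n (λ k → if ⌊ k F.≟ i ⌋ then 0 else s k)
        <⟨ +-mono-<-≤ (n<1+n (s i)) (sumFin-mono n others) ⟩
      suc (s i) + sumFin n (λ k → if ⌊ k F.≟ i ⌋ then 0 else suc (s i))
        ≡⟨ sumFin-remove n (λ _ → suc (s i)) i ⟨
      sumFin n (λ _ → suc (s i))     ≡⟨ sumFin-const n (suc (s i)) ⟩
      n * suc (s i)                  ≡⟨ *-comm n (suc (s i)) ⟩
      suc (s i) * n                  ∎
      where
      others : ∀ k → (if ⌊ k F.≟ i ⌋ then 0 else s k) ≤ (if ⌊ k F.≟ i ⌋ then 0 else suc (s i))
      others k with k F.≟ i
      ... | yes _ = z≤n
      ... | no _  = eq k i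
    lower : s i * n < count q X + n
    lower = begin-strict
      s i * n                        ≡⟨ *-comm (s i) n ⟩
      n * s i                        ≡⟨ sumFin-const n (s i) ⟨
      sumFin n (λ _ → s i)           ≡⟨ sumFin-remove n (λ _ → s i) i ⟩
      s i + sumFin n (λ k → if ⌊ k F.≟ i ⌋ then 0 else s i)
        <⟨ +-mono-<-≤ (n<1+n (s i)) (sumFin-mono n others) ⟩
      suc (s i) + sumFin n (λ k → if ⌊ k F.≟ i ⌋ then 0 else suc (s k))
        ≡⟨ sumFin-remove n (λ k → suc (s k)) i ⟨
      sumFin n (λ k → 1 + s k)       ≡⟨ sumFin-+ n (λ _ → 1) s ⟩
      sumFin n (λ _ → 1) + sumFin n s ≡⟨ cong₂ _+_ (≡.trans (sumFin-const n 1) (*-identityʳ n)) (count-fibres c q X) ⟩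
      n + count q X                  ≡⟨ +-comm n _ ⟩
      count q X + n                  ∎
      where
      others : ∀ k → (if ⌊ k F.≟ i ⌋ then 0 else s i) ≤ (if ⌊ k F.≟ i ⌋ then 0 else suc (s k))
      others k with k F.≟ i
      ... | yes _ = z≤n
      ... | no _  = eq i k

-- A fair subset for two laminar families.

module NashWilliams {A B : Set} (_≟_ : DecidableEquality A) (_≟ᴮ_ : DecidableEquality B) where
  open Laminar _≟_ _≟ᴮ_

  module _ (ℓs ms : List (A → B)) (chainℓ : AllPairs Refines ℓs) (chainm : AllPairs Refines ms)
           (X : List A) (uX : Unique X) (n : ℕ) where
    open Equitable X {suc n}

    private
      -- The energy is a sum over finitely many sets. The labels taken on `X` supply them, every
      -- other class being empty.
      classes : List (A → Bool)
      classes = cartesianProductWith (λ ℓ a → inClass ℓ (ℓ a)) (ℓs ++ ms) X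

      bisect : ∀ s → ∃ λ d → All (λ q → Bisects d (λ x → s x ∧ q x) X) classes
      bisect s with bisection ℓs ms chainℓ chainm (filter (λ x → T? (s x)) X) (filter⁺ _ uX)
      ... | d , bis = d , Allₚ.cartesianProductWith⁺ (≡.setoid _) (≡.setoid _) _ (ℓs ++ ms) X
              (λ {ℓ} {a} ℓ∈ a∈ → subst₂ Close (counts (inClass ℓ (ℓ a)) d) (counts (inClass ℓ (ℓ a)) (λ x → not (d x)))
                (All.lookup bis ℓ∈ (ℓ a)))
        where
        counts : ∀ (q d : A → Bool) →
          count (λ x → q x ∧ d x) (filter (λ x → T? (s x)) X) ≡ count (λ x → (s x ∧ q x) ∧ d x) X
        counts q d = ≡.trans (count-filter s _ X) (count-cong (λ x → sym (∧-assoc (s x) (q x) (d x))) X)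

    -- The subset is colour class `zero` of an equitable colouring with `suc n` colours, reached
    -- from the constant colouring.
    fairSubset : ∃ λ (c : A → Bool) → ∀ {ℓ} → ℓ ∈ˡ ℓs ++ ms → ∀ b →
      Near (count (λ x → inClass ℓ b x ∧ c x) X) (count (inClass ℓ b) X) (suc n)
    fairSubset with equitable classes bisect (λ _ → zero)
    ... | c , eq = (λ x → ⌊ c x F.≟ zero ⌋) , near
      where
      near : ∀ {ℓ} → ℓ ∈ˡ ℓs ++ ms → ∀ b →
        Near (count (λ x → inClass ℓ b x ∧ ⌊ c x F.≟ zero ⌋) X) (count (inClass ℓ b) X) (suc n)
      near {ℓ} ℓ∈ b with extract (inClass ℓ b) X
      -- The label `b` does not occur on `X`: both counts are 0.
      ... | inj₂ none
        rewrite n≤0⇒n≡0 (subst (count (λ x → inClass ℓ b x ∧ ⌊ c x F.≟ zero ⌋) X ≤_) none (count-∧-≤ _ _ X))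
              | none = bounds (s≤s z≤n) (s≤s z≤n)
      ... | inj₁ (a , X′ , X↭ , a∼b) with ℓ a ≟ᴮ b
      ...   | yes ≡.refl = equitable-Near (All.lookup eq
                (∈-cartesianProductWith⁺ (λ ℓ a → inClass ℓ (ℓ a)) ℓ∈ (∈-resp-↭ (↭-sym X↭) (here ≡.refl)))) zero

-- Tabulated lists, finite products and binomial coefficients.

⌊⌋-∧ : {P Q R : Set} (P? : Dec P) (Q? : Dec Q) (R? : Dec R) →
  (P → Q × R) → (Q → R → P) → ⌊ P? ⌋ ≡ (⌊ Q? ⌋ ∧ ⌊ R? ⌋)
⌊⌋-∧ P? (yes q) R? to from = ⌊⌋-cong P? R? (λ p → proj₂ (to p)) (from q)
⌊⌋-∧ P? (no ¬q) R? to from = ⌊⌋-false P? (λ p → ¬q (proj₁ (to p)))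

tabulate-injective : ∀ {A : Set} {n} {f g : Fin n → A} → tabulate f ≡ tabulate g → f ≗ g
tabulate-injective eq zero = ∷-injectiveˡ eq
tabulate-injective eq (suc i) = tabulate-injective (∷-injectiveʳ eq) i

count-tabulate : ∀ {A : Set} n (f : Fin n → A) (p : A → Bool) →
  count p (tabulate f) ≡ countFin n (λ i → p (f i))
count-tabulate zero f p = ≡.refl
count-tabulate (suc n) f p = cong (𝟙 (p (f zero)) +_) (count-tabulate n (λ i → f (suc i)) p)

countFin-cong : ∀ n {p q : Fin n → Bool} → p ≗ q → countFin n p ≡ countFin n q
countFin-cong n eq = sumFin-cong n (λ i → cong 𝟙 (eq i))

sumFin-if : ∀ n b (f : Fin n → ℕ) →
  (if b then sumFin n f else 0) ≡ sumFin n (λ i → if b then f i else 0)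
sumFin-if n true f = ≡.refl
sumFin-if n false f = sym (sumFin-zero n (λ _ → ≡.refl))

sumFin-<-at : ∀ n {f g : Fin n → ℕ} i → (∀ k → f k ≤ g k) → f i < g i → sumFin n f < sumFin n g
sumFin-<-at (suc n) zero le lt = +-mono-<-≤ lt (sumFin-mono n (λ k → le (suc k)))
sumFin-<-at (suc n) (suc i) le lt = +-mono-≤-< (le zero) (sumFin-<-at n i (λ k → le (suc k)) lt)

prodFin-cong : ∀ n {f g : Fin n → ℕ} → f ≗ g → prodFin n f ≡ prodFin n g
prodFin-cong zero eq = ≡.refl
prodFin-cong (suc n) eq = cong₂ _*_ (eq zero) (prodFin-cong n (λ i → eq (suc i)))

prodFin-one : ∀ n {f : Fin n → ℕ} → (∀ i → f i ≡ 1) → prodFin n f ≡ 1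
prodFin-one zero eq = ≡.refl
prodFin-one (suc n) eq rewrite eq zero | prodFin-one n (λ i → eq (suc i)) = ≡.refl

-- Products that differ in one factor have the ratio of these factors; the cross-multiplied form
-- takes in the binomial identities without division.
prodFin-change : ∀ n {f g : Fin n → ℕ} i {s t} → (∀ k → k ≢ i → f k ≡ g k) →
  f i * s ≡ g i * t → prodFin n f * s ≡ prodFin n g * t
prodFin-change (suc n) {f} {g} zero {s} {t} same eq
  rewrite prodFin-cong n {λ k → f (suc k)} {λ k → g (suc k)} (λ k → same (suc k) λ ()) = begin
  f zero * P * s   ≡⟨ rearrange (f zero) P s ⟩
  f zero * s * P   ≡⟨ cong (_* P) eq ⟩
  g zero * t * P   ≡⟨ rearrange (g zero) t P ⟩
  g zero * P * t   ∎
  where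
  open ≡.≡-Reasoning
  P = prodFin n (λ k → g (suc k))
  rearrange : ∀ a b c → a * b * c ≡ a * c * b
  rearrange = solve-∀
prodFin-change (suc n) {f} {g} (suc i) {s} {t} same eq rewrite same zero (λ ()) = begin
  g zero * prodFin n (λ k → f (suc k)) * s   ≡⟨ *-assoc (g zero) _ s ⟩
  g zero * (prodFin n (λ k → f (suc k)) * s) ≡⟨ cong (g zero *_) (prodFin-change n i
      (λ k k≢i → same (suc k) (λ eq → k≢i (Fₚ.suc-injective eq))) eq) ⟩
  g zero * (prodFin n (λ k → g (suc k)) * t) ≡⟨ *-assoc (g zero) _ t ⟨
  g zero * prodFin n (λ k → g (suc k)) * t   ∎
  where open ≡.≡-Reasoning

-- Absorption identity. Pascal's rule splits the left side, and the induction hypotheses for `k` and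
-- `suc k` recombine by Pascal's rule one row higher up.
C-absorb : ∀ n k → (suc n C suc k) * suc k ≡ (n C k) * suc n
C-absorb n zero rewrite nC1≡n (suc n) = *-comm (suc n) 1
C-absorb zero (suc k)
  rewrite k>n⇒nCk≡0 {1} {suc (suc k)} (s≤s (s≤s z≤n)) | k>n⇒nCk≡0 {0} {suc k} (s≤s z≤n) = ≡.refl
C-absorb (suc n) (suc k) = begin
  (suc (suc n) C suc (suc k)) * suc (suc k)
    ≡⟨ cong (_* suc (suc k)) (nCk+nC[k+1]≡[n+1]C[k+1] (suc n) (suc k)) ⟨
  (M + (suc n C suc (suc k))) * suc (suc k)
    ≡⟨ expand M (suc n C suc (suc k)) k ⟩
  M + (M * suc k + (suc n C suc (suc k)) * suc (suc k))
    ≡⟨ cong (M +_) (cong₂ _+_ (C-absorb n k) (C-absorb n (suc k))) ⟩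
  M + ((n C k) * suc n + (n C suc k) * suc n)
    ≡⟨ cong (M +_) (*-distribʳ-+ (suc n) (n C k) (n C suc k)) ⟨
  M + ((n C k) + (n C suc k)) * suc n
    ≡⟨ cong (λ c → M + c * suc n) (nCk+nC[k+1]≡[n+1]C[k+1] n k) ⟩
  M + M * suc n
    ≡⟨ *-suc M (suc n) ⟨
  M * suc (suc n) ∎
  where
  open ≡.≡-Reasoning
  M = suc n C suc k
  expand : ∀ a b k → (a + b) * (2 + k) ≡ a + (a * (1 + k) + b * (2 + k))
  expand = solve-∀

-- The companion identity, with `s` for `suc n - k` to avoid truncated subtraction: it is Pascal's
-- rule times `suc n` with the part accounted for by `C-absorb` cancelled.
C-absorb′ : ∀ n k s → k + s ≡ suc n → (n C k) * suc n ≡ (suc n C k) * s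
C-absorb′ n zero s ≡.refl = ≡.refl
C-absorb′ n (suc k) s eq = +-cancelˡ-≡ ((n C k) * suc n) _ _ (begin
  (n C k) * suc n + (n C suc k) * suc n     ≡⟨ *-distribʳ-+ (suc n) (n C k) (n C suc k) ⟨
  ((n C k) + (n C suc k)) * suc n           ≡⟨ cong₂ _*_ (nCk+nC[k+1]≡[n+1]C[k+1] n k) (sym eq) ⟩
  (suc n C suc k) * (suc k + s)             ≡⟨ *-distribˡ-+ (suc n C suc k) (suc k) s ⟩
  (suc n C suc k) * suc k + (suc n C suc k) * s ≡⟨ cong (_+ (suc n C suc k) * s) (C-absorb n k) ⟩
  (n C k) * suc n + (suc n C suc k) * s     ∎)
  where open ≡.≡-Reasoning

1C≤1 : ∀ {m} → m ≤ 1 → 1 C m ≡ 1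
1C≤1 z≤n = ≡.refl
1C≤1 (s≤s z≤n) = ≡.refl

-- Arithmetic of rounded quotients.

Near-refl : ∀ a → Near a a 1
Near-refl a = bounds (≤-reflexive (sym (*-identityʳ (suc a))))
  (≤-reflexive (≡.trans (cong suc (*-identityʳ a)) (+-comm 1 a)))

-- The quotients `m * i / p` and `m * s / p` add up to the integer `m`, so the upper bound for one
-- is the lower bound for the other.
Near-complement : ∀ {x y m i s p} → x + y ≡ m → i + s ≡ p → Near x (m * i) p → Near y (m * s) p
Near-complement {x} {y} {_} {i} {s} ≡.refl ≡.refl (bounds above below) = bounds
  (+-cancelˡ-< (x * (i + s)) _ _ (begin-strict
    x * (i + s) + (x + y) * s                  <⟨ +-monoˡ-< ((x + y) * s) below ⟩
    (x + y) * i + (i + s) + (x + y) * s        ≡⟨ id₁ x y i s ⟩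
    x * (i + s) + suc y * (i + s)              ∎))
  (+-cancelˡ-< ((x + y) * i) _ _ (begin-strict
    (x + y) * i + y * (i + s)                  <⟨ +-monoˡ-< (y * (i + s)) above ⟩
    suc x * (i + s) + y * (i + s)              ≡⟨ id₂ x y i s ⟩
    (x + y) * i + ((x + y) * s + (i + s))      ∎))
  where
  open ≤-Reasoning
  id₁ : ∀ x y i s → (x + y) * i + (i + s) + (x + y) * s ≡ x * (i + s) + suc y * (i + s)
  id₁ = solve-∀
  id₂ : ∀ x y i s → suc x * (i + s) + y * (i + s) ≡ (x + y) * i + ((x + y) * s + (i + s))
  id₂ = solve-∀

-- Rounding a s / p to an integer a′ does not move a′ / b′ out of the
-- integer interval around a / b = (a s / p) / b′.
Near-trans : ∀ {x a a′ b b′ s p} → 0 < s → b′ * p ≡ b * s →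
  Near a′ (a * s) p → Near x a′ b′ → Near x a b
Near-trans {x} {a} {a′} {b} {b′} {s} {p} s>0 b′p≡bs (bounds above below) (bounds above′ below′) = bounds
  (*-cancelʳ-< s _ _ (begin-strict
    a * s               <⟨ above ⟩
    suc a′ * p          ≤⟨ *-monoˡ-≤ p above′ ⟩
    suc x * b′ * p      ≡⟨ scale (suc x) ⟩
    suc x * b * s       ∎))
  (*-cancelʳ-< s _ _ (+-cancelʳ-< p _ _ (begin-strict
    x * b * s + p       ≡⟨ cong (_+ p) (scale x) ⟨
    x * b′ * p + p      ≡⟨ +-comm (x * b′ * p) p ⟩
    suc (x * b′) * p    ≤⟨ *-monoˡ-≤ p below′ ⟩
    (a′ + b′) * p       ≡⟨ *-distribʳ-+ p a′ b′ ⟩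
    a′ * p + b′ * p     <⟨ +-monoˡ-< (b′ * p) below ⟩
    a * s + p + b′ * p  ≡⟨ cong (a * s + p +_) b′p≡bs ⟩
    a * s + p + b * s   ≡⟨ regroup a b s p ⟩
    (a + b) * s + p     ∎)))
  where
  open ≤-Reasoning
  scale : ∀ y → y * b′ * p ≡ y * b * s
  scale y = ≡.trans (*-assoc y b′ p) (≡.trans (cong (y *_) b′p≡bs) (sym (*-assoc y b s)))
  regroup : ∀ a b s p → a * s + p + b * s ≡ (a + b) * s + p
  regroup = solve-∀

-- Pushforward of multiplicities and counting of hinges.

-- The pushforward of a multiset along `Ψ`. By unfolding, `numberFn Ψ` is the pushforward of the
-- constant 1.
push : ∀ {n m} → (Fin n → Fin m) → (Fin n → ℕ) → Fin m → ℕ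
push {n} Ψ μ u = sumFin n (λ w → if ⌊ Ψ w F.≟ u ⌋ then μ w else 0)

push-cong : ∀ {n m} (Ψ : Fin n → Fin m) {μ ν} → μ ≗ ν → push Ψ μ ≗ push Ψ ν
push-cong {n} Ψ eq u = sumFin-cong n (λ w → cong (λ x → if ⌊ Ψ w F.≟ u ⌋ then x else 0) (eq w))

push-mono : ∀ {n m} (Ψ : Fin n → Fin m) {μ ν} → (∀ w → μ w ≤ ν w) → ∀ u → push Ψ μ u ≤ push Ψ ν u
push-mono {n} Ψ {μ} {ν} le u = sumFin-mono n λ w → mono ⌊ Ψ w F.≟ u ⌋ w
  where
  mono : ∀ b w → (if b then μ w else 0) ≤ (if b then ν w else 0)
  mono true w = le w
  mono false w = z≤n

push-id : ∀ {n} (μ : Fin n → ℕ) → push (λ w → w) μ ≗ μ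
push-id {n} μ u = sumFin-single n μ u

push-∘ : ∀ {l n m} (Φ : Fin l → Fin n) (Ψ : Fin n → Fin m) (μ : Fin l → ℕ) →
  push Ψ (push Φ μ) ≗ push (λ i → Ψ (Φ i)) μ
push-∘ {l} {n} {m} Φ Ψ μ u = begin
  sumFin n (λ w → if ⌊ Ψ w F.≟ u ⌋ then push Φ μ w else 0)
    ≡⟨ sumFin-cong n (λ w → sumFin-if l ⌊ Ψ w F.≟ u ⌋ _) ⟩
  sumFin n (λ w → sumFin l (λ i → if ⌊ Ψ w F.≟ u ⌋ then (if ⌊ Φ i F.≟ w ⌋ then μ i else 0) else 0))
    ≡⟨ sumFin-swap n l _ ⟩
  sumFin l (λ i → sumFin n (λ w → if ⌊ Ψ w F.≟ u ⌋ then (if ⌊ Φ i F.≟ w ⌋ then μ i else 0) else 0))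
    ≡⟨ sumFin-cong l (λ i → ≡.trans (sumFin-cong n (λ w → exchange i w)) (sumFin-single n _ (Φ i))) ⟩
  sumFin l (λ i → if ⌊ Ψ (Φ i) F.≟ u ⌋ then μ i else 0) ∎
  where
  open ≡.≡-Reasoning
  swap-if : ∀ b c (x : ℕ) → (if b then (if c then x else 0) else 0) ≡ (if c then (if b then x else 0) else 0)
  swap-if true  true  x = ≡.refl
  swap-if true  false x = ≡.refl
  swap-if false true  x = ≡.refl
  swap-if false false x = ≡.refl
  exchange : ∀ i w → (if ⌊ Ψ w F.≟ u ⌋ then (if ⌊ Φ i F.≟ w ⌋ then μ i else 0) else 0)
    ≡ (if ⌊ w F.≟ Φ i ⌋ then (if ⌊ Ψ w F.≟ u ⌋ then μ i else 0) else 0)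
  exchange i w = ≡.trans (swap-if ⌊ Ψ w F.≟ u ⌋ ⌊ Φ i F.≟ w ⌋ (μ i))
    (cong (λ b → if b then (if ⌊ Ψ w F.≟ u ⌋ then μ i else 0) else 0)
      (⌊⌋-cong (Φ i F.≟ w) (w F.≟ Φ i) sym sym))

𝟙-∧ : ∀ b c → 𝟙 (b ∧ c) ≡ (if b then 𝟙 c else 0)
𝟙-∧ true c = ≡.refl
𝟙-∧ false c = ≡.refl

-- The common form of `degIn` and `hingesAt`; the latter is the degree in the edge set consisting of
-- `e` alone.
at : ∀ {n l} → (Fin l → Fin n) → (Fin l → Bool) → Fin n → ℕ
at {l = l} ψ T v = countFin l (λ h → ⌊ ψ h F.≟ v ⌋ ∧ T h)

at-push : ∀ {n l} (ψ : Fin l → Fin n) (T : Fin l → Bool) → at ψ T ≗ push ψ (λ h → 𝟙 (T h))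
at-push {l = l} ψ T v = sumFin-cong l (λ h → 𝟙-∧ ⌊ ψ h F.≟ v ⌋ (T h))

-- Hinge counts are themselves pushforwards from the set of hinges, so this is functoriality of
-- `push`.
at-amalgamate : ∀ {n m l} (ψG : Fin l → Fin n) (Ψ : Fin n → Fin m) {ψF : Fin l → Fin m} →
  (∀ h → Ψ (ψG h) ≡ ψF h) → ∀ T u → at ψF T u ≡ push Ψ (at ψG T) u
at-amalgamate {l = l} ψG Ψ {ψF} comm T u = begin
  at ψF T u                       ≡⟨ at-push ψF T u ⟩
  push ψF (λ h → 𝟙 (T h)) u
    ≡⟨ sumFin-cong l (λ h → cong (λ x → if ⌊ x F.≟ u ⌋ then 𝟙 (T h) else 0) (sym (comm h))) ⟩
  push (λ h → Ψ (ψG h)) (λ h → 𝟙 (T h)) u ≡⟨ push-∘ ψG Ψ _ u ⟨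
  push Ψ (push ψG (λ h → 𝟙 (T h))) u      ≡⟨ push-cong Ψ (at-push ψG T) u ⟨
  push Ψ (at ψG T) u ∎
  where open ≡.≡-Reasoning

-- Double counting: after the sums are exchanged, each hinge meets exactly one edge, its own.
degIn-hingesAt : (𝓖 : Hypergraph) (S : EdgeSet 𝓖) (v : Fin (nV 𝓖)) →
  degIn 𝓖 S v ≡ sumFin (nE 𝓖) (λ e → if S e then hingesAt 𝓖 v e else 0)
degIn-hingesAt 𝓖 S v = sym (begin
  sumFin m (λ e → if S e then hingesAt 𝓖 v e else 0)
    ≡⟨ sumFin-cong m (λ e → sumFin-if l (S e) _) ⟩
  sumFin m (λ e → sumFin l (λ h → if S e then 𝟙 (on h ∧ ⌊ φ 𝓖 h F.≟ e ⌋) else 0))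
    ≡⟨ sumFin-swap m l _ ⟩
  sumFin l (λ h → sumFin m (λ e → if S e then 𝟙 (on h ∧ ⌊ φ 𝓖 h F.≟ e ⌋) else 0))
    ≡⟨ sumFin-cong l (λ h → ≡.trans (sumFin-cong m (λ e → move h e)) (sumFin-single m _ (φ 𝓖 h))) ⟩
  sumFin l (λ h → 𝟙 (on h ∧ S (φ 𝓖 h))) ∎)
  where
  open ≡.≡-Reasoning
  m = nE 𝓖
  l = nH 𝓖
  on : Fin l → Bool
  on h = ⌊ ψ 𝓖 h F.≟ v ⌋
  bools : ∀ b c d → (if b then 𝟙 (c ∧ d) else 0) ≡ (if d then 𝟙 (c ∧ b) else 0)
  bools true  true  true  = ≡.refl
  bools true  true  false = ≡.refl
  bools true  false true  = ≡.refl
  bools true  false false = ≡.refl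
  bools false true  true  = ≡.refl
  bools false true  false = ≡.refl
  bools false false true  = ≡.refl
  bools false false false = ≡.refl
  move : ∀ h e → (if S e then 𝟙 (on h ∧ ⌊ φ 𝓖 h F.≟ e ⌋) else 0)
               ≡ (if ⌊ e F.≟ φ 𝓖 h ⌋ then 𝟙 (on h ∧ S e) else 0)
  move h e = ≡.trans (bools (S e) (on h) ⌊ φ 𝓖 h F.≟ e ⌋)
    (cong (λ b → if b then 𝟙 (on h ∧ S e) else 0) (⌊⌋-cong (φ 𝓖 h F.≟ e) (e F.≟ φ 𝓖 h) sym sym))

hasType? : (𝓖 : Hypergraph) (μ : Fin (nV 𝓖) → ℕ) (e : Fin (nE 𝓖)) → Dec (∀ v → hingesAt 𝓖 v e ≡ μ v)
hasType? 𝓖 μ e = Fₚ.all? (λ v → hingesAt 𝓖 v e N.≟ μ v)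

ofType : (𝓖 : Hypergraph) → EdgeSet 𝓖 → (Fin (nV 𝓖) → ℕ) → EdgeSet 𝓖
ofType 𝓖 S μ e = S e ∧ ⌊ hasType? 𝓖 μ e ⌋

multIn-cong : (𝓖 : Hypergraph) (S : EdgeSet 𝓖) {μ ν : Fin (nV 𝓖) → ℕ} → μ ≗ ν →
  multIn 𝓖 S μ ≡ multIn 𝓖 S ν
multIn-cong 𝓖 S {μ} {ν} eq = countFin-cong (nE 𝓖) (λ e → cong (S e ∧_)
  (⌊⌋-cong (hasType? 𝓖 μ e) (hasType? 𝓖 ν e) (λ a v → ≡.trans (a v) (eq v)) (λ a v → ≡.trans (a v) (sym (eq v)))))

-- Each edge of type `μ` has `μ v` hinges at `v`. This is how a fair choice of hinges comes to
-- control numbers of edges.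
degIn-ofType : (𝓖 : Hypergraph) (S : EdgeSet 𝓖) (μ : Fin (nV 𝓖) → ℕ) (v : Fin (nV 𝓖)) →
  degIn 𝓖 (ofType 𝓖 S μ) v ≡ multIn 𝓖 S μ * μ v
degIn-ofType 𝓖 S μ v = ≡.trans (degIn-hingesAt 𝓖 (ofType 𝓖 S μ) v)
  (≡.trans (sumFin-cong (nE 𝓖) same) (scale (nE 𝓖) (ofType 𝓖 S μ)))
  where
  same : ∀ e → (if ofType 𝓖 S μ e then hingesAt 𝓖 v e else 0) ≡ (if ofType 𝓖 S μ e then μ v else 0)
  same e with S e | hasType? 𝓖 μ e
  ... | true  | yes all = all v
  ... | true  | no _    = ≡.refl
  ... | false | _       = ≡.refl
  scale : ∀ n (P : Fin n → Bool) → sumFin n (λ i → if P i then μ v else 0) ≡ countFin n P * μ v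
  scale zero P = ≡.refl
  scale (suc n) P with P zero
  ... | true  = cong (μ v +_) (scale n (λ i → P (suc i)))
  ... | false = scale n (λ i → P (suc i))

-- Fair detachments.

-- `nothing` selects all edges, so that (A1) and (A2), and likewise (A3) and (A4), are proved
-- together.
select : ∀ {m k} → (Fin m → Fin k) → Maybe (Fin k) → Fin m → Bool
select f nothing  e = true
select f (just j) e = ⌊ f e F.≟ j ⌋

-- The product runs over all vertices: one outside the multiset contributes `g u C 0`, which is 1.
binomials : ∀ {n} → (Fin n → ℕ) → (Fin n → ℕ) → ℕ
binomials {n} g μ = prodFin n (λ u → g u C μ u)

-- The form that passes through the induction. A set of new vertices is a function `μ` with values
-- at most 1, and the multiset below it is `push Ψ μ`; this replaces the families of sets in (A3)
-- and (A4).
record FairDetachment (𝓕 : Hypergraph) {k : ℕ} (f : Fin (nE 𝓕) → Fin k) (g : Fin (nV 𝓕) → ℕ) : Set where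
  field
    n        : ℕ
    Ψ        : Fin n → Fin (nV 𝓕)
    ψG       : Fin (nH 𝓕) → Fin n
    commutes : ∀ h → Ψ (ψG h) ≡ ψ 𝓕 h
    number   : ∀ u → numberFn Ψ u ≡ g u
    simple   : SimpleHG (detachment 𝓕 n ψG)
    degrees  : ∀ c v → Near (degIn (detachment 𝓕 n ψG) (select f c) v)
                            (degIn 𝓕 (select f c) (Ψ v)) (g (Ψ v))
    mults    : ∀ c μ → (∀ w → μ w ≤ 1) →
               Near (multIn (detachment 𝓕 n ψG) (select f c) μ)
                    (multIn 𝓕 (select f c) (push Ψ μ)) (binomials g (push Ψ μ))

-- Splitting one new vertex off `α`.

module Split (𝓖 : Hypergraph) {k : ℕ} (f : Fin (nE 𝓖) → Fin k) (α : Fin (nV 𝓖)) (p : ℕ) where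

  private
    nᵥ = nV 𝓖
    nₑ = nE 𝓖
    nₕ = nH 𝓖

  -- One type with decidable equality for all five labellings: edges and colours enter through
  -- `toℕ`, an edge type as the table of its hinge counts.
  Label : Set
  Label = List ℕ

  edgeLabel colourLabel trivialLabel typeLabel colouredTypeLabel : Fin nₕ → Label
  edgeLabel h = toℕ (φ 𝓖 h) ∷ []
  colourLabel h = toℕ (f (φ 𝓖 h)) ∷ []
  trivialLabel h = []
  typeLabel h = tabulate (λ v → hingesAt 𝓖 v (φ 𝓖 h))
  colouredTypeLabel h = toℕ (f (φ 𝓖 h)) ∷ typeLabel h

  open Laminar (F._≟_ {nₕ}) (≡-dec N._≟_)

  -- In general neither of colour and type refines the other, hence two chains. The one class of
  -- `trivialLabel` is the set of all hinges at `α`.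
  edgeChain typeChain : List (Fin nₕ → Label)
  edgeChain = edgeLabel ∷ colourLabel ∷ trivialLabel ∷ []
  typeChain = colouredTypeLabel ∷ typeLabel ∷ []

  edgeChain-refines : AllPairs Refines edgeChain
  edgeChain-refines =
    ((λ x y eq → cong (λ e → toℕ (f e) ∷ []) (Fₚ.toℕ-injective (∷-injectiveˡ eq)))
      ∷ (λ _ _ _ → ≡.refl) ∷ [])
    ∷ ((λ _ _ _ → ≡.refl) ∷ []) ∷ [] ∷ []

  typeChain-refines : AllPairs Refines typeChain
  typeChain-refines = ((λ x y eq → ∷-injectiveʳ eq) ∷ []) ∷ [] ∷ []

  hinges : List (Fin nₕ)
  hinges = filter (λ h → T? ⌊ ψ 𝓖 h F.≟ α ⌋) (allFin nₕ)

  count-hinges : ∀ q → count q hinges ≡ at (ψ 𝓖) q α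
  count-hinges q = ≡.trans (count-filter (λ h → ⌊ ψ 𝓖 h F.≟ α ⌋) q (allFin nₕ))
    (count-tabulate nₕ (λ h → h) _)

  -- Abstract, since with-abstraction over the chosen hinges would otherwise
  -- unfold the whole recolouring process.
  abstract
    fair : ∃ λ (c : Fin nₕ → Bool) → ∀ {ℓ} → ℓ ∈ˡ edgeChain ++ typeChain → ∀ b →
      Near (count (λ h → inClass ℓ b h ∧ c h) hinges) (count (inClass ℓ b) hinges) (suc p)
    fair = NashWilliams.fairSubset (F._≟_ {nₕ}) (≡-dec N._≟_) edgeChain typeChain
      edgeChain-refines typeChain-refines hinges (filter⁺ _ (allFin⁺ nₕ)) p

  chosen : Fin nₕ → Bool
  chosen = proj₁ fair

  -- The new vertex is `zero` and `suc` embeds the old ones, so `suc α` is what remains of `α`.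
  ψ′ : Fin nₕ → Fin (suc nᵥ)
  ψ′ h = if ⌊ ψ 𝓖 h F.≟ α ⌋ ∧ chosen h then zero else suc (ψ 𝓖 h)

  𝓖′ : Hypergraph
  𝓖′ = detachment 𝓖 (suc nᵥ) ψ′

  merge : Fin (suc nᵥ) → Fin nᵥ
  merge zero = α
  merge (suc v) = v

  merge-ψ′ : ∀ h → merge (ψ′ h) ≡ ψ 𝓖 h
  merge-ψ′ h with ψ 𝓖 h F.≟ α | chosen h
  ... | yes eq | true  = sym eq
  ... | yes _  | false = ≡.refl
  ... | no _   | _     = ≡.refl

  push-merge : ∀ (μ : Fin (suc nᵥ) → ℕ) u →
    push merge μ u ≡ (if ⌊ α F.≟ u ⌋ then μ zero else 0) + μ (suc u)
  push-merge μ u = cong ((if ⌊ α F.≟ u ⌋ then μ zero else 0) +_) (sumFin-single nᵥ (λ v → μ (suc v)) u)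

  push-merge-α : ∀ μ → push merge μ α ≡ μ zero + μ (suc α)
  push-merge-α μ = ≡.trans (push-merge μ α)
    (cong (λ b → (if b then μ zero else 0) + μ (suc α)) (⌊⌋-true (α F.≟ α) ≡.refl))

  push-merge-other : ∀ μ {u} → u ≢ α → push merge μ u ≡ μ (suc u)
  push-merge-other μ {u} u≢α = ≡.trans (push-merge μ u)
    (cong (λ b → (if b then μ zero else 0) + μ (suc u)) (⌊⌋-false (α F.≟ u) (≢-sym u≢α)))

  degIn-merge : ∀ (S : EdgeSet 𝓖) u → degIn 𝓖 S u ≡ push merge (degIn 𝓖′ S) u
  degIn-merge S = at-amalgamate ψ′ merge merge-ψ′ (λ h → S (φ 𝓖 h))

  -- When a label class consists of the hinges on the edges of `S`, fairness of the choice compares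
  -- the degrees in `S` of the new vertex and of `α`.
  near-class : {ℓ : Fin nₕ → Label} → ℓ ∈ˡ edgeChain ++ typeChain → (b : Label) (S : EdgeSet 𝓖) →
    (∀ h → inClass ℓ b h ≡ S (φ 𝓖 h)) → Near (degIn 𝓖′ S zero) (degIn 𝓖 S α) (suc p)
  near-class {ℓ} ℓ∈ b S eq = subst₂ (λ x y → Near x y (suc p))
    (≡.trans (count-hinges _) (countFin-cong nₕ new))
    (≡.trans (count-hinges _) (countFin-cong nₕ (λ h → cong (⌊ ψ 𝓖 h F.≟ α ⌋ ∧_) (eq h))))
    (proj₂ fair ℓ∈ b)
    where
    new : (h : Fin nₕ) → (⌊ ψ 𝓖 h F.≟ α ⌋ ∧ (inClass ℓ b h ∧ chosen h)) ≡ (⌊ ψ′ h F.≟ zero ⌋ ∧ S (φ 𝓖 h))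
    new h rewrite eq h with ψ 𝓖 h F.≟ α | proj₁ fair h
    ... | yes _ | true  = ∧-identityʳ (S (φ 𝓖 h))
    ... | yes _ | false = ∧-zeroʳ (S (φ 𝓖 h))
    ... | no _  | _     = ≡.refl

  near-edge : ∀ e → Near (hingesAt 𝓖′ zero e) (hingesAt 𝓖 α e) (suc p)
  near-edge e = near-class (here ≡.refl) (toℕ e ∷ []) (λ e′ → ⌊ e′ F.≟ e ⌋) λ h →
    ⌊⌋-cong (≡-dec N._≟_ _ _) (φ 𝓖 h F.≟ e)
      (λ eq → Fₚ.toℕ-injective (∷-injectiveˡ eq)) (cong (λ e → toℕ e ∷ []))

  near-colour : ∀ c → Near (degIn 𝓖′ (select f c) zero) (degIn 𝓖 (select f c) α) (suc p)
  near-colour nothing = near-class (there (there (here ≡.refl))) [] (select f nothing) λ h →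
    ⌊⌋-true (≡-dec N._≟_ [] []) ≡.refl
  near-colour (just j) = near-class (there (here ≡.refl)) (toℕ j ∷ []) (select f (just j)) λ h →
    ⌊⌋-cong (≡-dec N._≟_ _ _) (f (φ 𝓖 h) F.≟ j)
      (λ eq → Fₚ.toℕ-injective (∷-injectiveˡ eq)) (cong (λ e → toℕ e ∷ []))

  near-type : ∀ c μ → Near (degIn 𝓖′ (ofType 𝓖 (select f c) μ) zero)
                           (degIn 𝓖 (ofType 𝓖 (select f c) μ) α) (suc p)
  near-type nothing μ = near-class (there (there (there (there (here ≡.refl))))) (tabulate μ)
    (ofType 𝓖 (select f nothing) μ) λ h →
    ⌊⌋-cong (≡-dec N._≟_ _ _) (hasType? 𝓖 μ (φ 𝓖 h)) tabulate-injective tabulate-cong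
  near-type (just j) μ = near-class (there (there (there (here ≡.refl)))) (toℕ j ∷ tabulate μ)
    (ofType 𝓖 (select f (just j)) μ) λ h →
    ⌊⌋-∧ (≡-dec N._≟_ _ _) (f (φ 𝓖 h) F.≟ j) (hasType? 𝓖 μ (φ 𝓖 h))
      (λ eq → Fₚ.toℕ-injective (∷-injectiveˡ eq) , tabulate-injective (∷-injectiveʳ eq))
      (λ eq all → cong₂ _∷_ (cong toℕ eq) (tabulate-cong all))

  -- The hinge counts of an edge in `𝓖` are the pushforward of those in `𝓖′`; together with the
  -- count at the new vertex they determine the count at `suc α` by cancellation.
  multIn-split : ∀ (S : EdgeSet 𝓖) (μ : Fin (suc nᵥ) → ℕ) →
    multIn 𝓖′ S μ ≡ countFin nₑ (λ e → ofType 𝓖 S (push merge μ) e ∧ ⌊ hingesAt 𝓖′ zero e N.≟ μ zero ⌋)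
  multIn-split S μ = countFin-cong nₑ λ e → ≡.trans
    (cong (S e ∧_) (⌊⌋-∧ (hasType? 𝓖′ μ e) (hasType? 𝓖 (push merge μ) e) (hingesAt 𝓖′ zero e N.≟ μ zero) (to e) (from e)))
    (sym (∧-assoc (S e) _ _))
    where
    to : ∀ e → (∀ w → hingesAt 𝓖′ w e ≡ μ w) →
      (∀ v → hingesAt 𝓖 v e ≡ push merge μ v) × (hingesAt 𝓖′ zero e ≡ μ zero)
    to e all = (λ v → ≡.trans (degIn-merge (λ e′ → ⌊ e′ F.≟ e ⌋) v) (push-cong merge all v)) , all zero
    from : ∀ e → (∀ v → hingesAt 𝓖 v e ≡ push merge μ v) → hingesAt 𝓖′ zero e ≡ μ zero →
      ∀ w → hingesAt 𝓖′ w e ≡ μ w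
    from e all eq zero = eq
    from e all eq (suc v) = +-cancelˡ-≡ (if ⌊ α F.≟ v ⌋ then μ zero else 0) _ _ (begin
      (if ⌊ α F.≟ v ⌋ then μ zero else 0) + hingesAt 𝓖′ (suc v) e
        ≡⟨ cong (λ x → (if ⌊ α F.≟ v ⌋ then x else 0) + hingesAt 𝓖′ (suc v) e) eq ⟨
      (if ⌊ α F.≟ v ⌋ then hingesAt 𝓖′ zero e else 0) + hingesAt 𝓖′ (suc v) e
        ≡⟨ push-merge (λ w → hingesAt 𝓖′ w e) v ⟨
      push merge (λ w → hingesAt 𝓖′ w e) v
        ≡⟨ degIn-merge (λ e′ → ⌊ e′ F.≟ e ⌋) v ⟨
      hingesAt 𝓖 v e
        ≡⟨ all v ⟩
      push merge μ v
        ≡⟨ push-merge μ v ⟩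
      (if ⌊ α F.≟ v ⌋ then μ zero else 0) + μ (suc v) ∎)
      where open ≡.≡-Reasoning

  module _ (new≤1 : ∀ e → hingesAt 𝓖′ zero e ≤ 1) where

    -- No edge has two hinges at the new vertex, so hinges there can be counted by their edges.
    degIn-new : ∀ (T : EdgeSet 𝓖) →
      degIn 𝓖′ T zero ≡ countFin nₑ (λ e → T e ∧ ⌊ hingesAt 𝓖′ zero e N.≟ 1 ⌋)
    degIn-new T = ≡.trans (degIn-hingesAt 𝓖′ T zero) (sumFin-cong nₑ λ e → bit (T e) (new≤1 e))
      where
      bit : ∀ b {x} → x ≤ 1 → (if b then x else 0) ≡ 𝟙 (b ∧ ⌊ x N.≟ 1 ⌋)
      bit false _ = ≡.refl
      bit true z≤n = ≡.refl
      bit true (s≤s z≤n) = ≡.refl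

    split-total : ∀ (T : EdgeSet 𝓖) →
      countFin nₑ (λ e → T e ∧ ⌊ hingesAt 𝓖′ zero e N.≟ 1 ⌋)
      + countFin nₑ (λ e → T e ∧ ⌊ hingesAt 𝓖′ zero e N.≟ 0 ⌋) ≡ countFin nₑ T
    split-total T = ≡.trans (sym (sumFin-+ nₑ _ _)) (sumFin-cong nₑ λ e → bit (T e) (new≤1 e))
      where
      bit : ∀ b {x} → x ≤ 1 → 𝟙 (b ∧ ⌊ x N.≟ 1 ⌋) + 𝟙 (b ∧ ⌊ x N.≟ 0 ⌋) ≡ 𝟙 b
      bit false _ = ≡.refl
      bit true z≤n = ≡.refl
      bit true (s≤s z≤n) = ≡.refl

    -- If `m` edges have type `push merge μ`, with `i` hinges each at `α`, then about
    -- `m * i / suc p` of these hinges move, one from each edge that obtains type `μ`.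
    near-mult-1 : ∀ c μ → μ zero ≡ 1 →
      Near (multIn 𝓖′ (select f c) μ)
           (multIn 𝓖 (select f c) (push merge μ) * push merge μ α) (suc p)
    near-mult-1 c μ eq = subst₂ (λ x y → Near x y (suc p))
      (≡.trans (degIn-new _) (sym (≡.trans (multIn-split (select f c) μ)
        (countFin-cong nₑ λ e → cong (λ y → ofType 𝓖 (select f c) (push merge μ) e ∧ ⌊ hingesAt 𝓖′ zero e N.≟ y ⌋) eq))))
      (degIn-ofType 𝓖 (select f c) (push merge μ) α)
      (near-type c (push merge μ))

    -- The edges of the type that lose no hinge are the complement of those that lose one, about
    -- `m * s / suc p` in number.
    near-mult-0 : ∀ c μ s → μ zero ≡ 0 → push merge μ α + s ≡ suc p →
      Near (multIn 𝓖′ (select f c) μ)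
           (multIn 𝓖 (select f c) (push merge μ) * s) (suc p)
    near-mult-0 c μ s eq is≡p = Near-complement
      (≡.trans (cong₂ _+_ (degIn-new (ofType 𝓖 (select f c) (push merge μ)))
        (≡.trans (multIn-split (select f c) μ) (countFin-cong nₑ λ e →
          cong (λ y → ofType 𝓖 (select f c) (push merge μ) e ∧ ⌊ hingesAt 𝓖′ zero e N.≟ y ⌋) eq)))
        (split-total (ofType 𝓖 (select f c) (push merge μ))))
      is≡p
      (subst (λ y → Near (degIn 𝓖′ (ofType 𝓖 (select f c) (push merge μ)) zero) y (suc p))
        (degIn-ofType 𝓖 (select f c) (push merge μ) α) (near-type c (push merge μ)))

  module _ (g : Fin nᵥ → ℕ) (gα : g α ≡ suc p) (p>0 : 0 < p) (simple : SimpleFn 𝓖 g) where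

    g′ : Fin (suc nᵥ) → ℕ
    g′ zero = 1
    g′ (suc v) = if ⌊ v F.≟ α ⌋ then p else g v

    g′-α : g′ (suc α) ≡ p
    g′-α rewrite ⌊⌋-true (α F.≟ α) ≡.refl = ≡.refl

    g′-other : ∀ {v} → v ≢ α → g′ (suc v) ≡ g v
    g′-other {v} v≢α rewrite ⌊⌋-false (v F.≟ α) v≢α = ≡.refl

    g′-positive : (∀ u → 1 ≤ g u) → ∀ w → 1 ≤ g′ w
    g′-positive pos zero = ≤-refl
    g′-positive pos (suc v) with v F.≟ α
    ... | yes _ = p>0
    ... | no _  = pos v

    g′-decreases : sumFin (suc nᵥ) (λ w → g′ w ∸ 1) < sumFin nᵥ (λ v → g v ∸ 1)
    g′-decreases = sumFin-<-at nᵥ α weak strict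
      where
      weak : ∀ v → g′ (suc v) ∸ 1 ≤ g v ∸ 1
      weak v with v F.≟ α
      ... | yes ≡.refl rewrite gα = m∸n≤m p 1
      ... | no _ = ≤-refl
      strict : g′ (suc α) ∸ 1 < g α ∸ 1
      strict rewrite g′-α | gα = ∸-monoʳ-< {p} {1} {0} (s≤s z≤n) p>0

    hingesAt-α : ∀ e → hingesAt 𝓖 α e ≡ hingesAt 𝓖′ zero e + hingesAt 𝓖′ (suc α) e
    hingesAt-α e = ≡.trans (degIn-merge (λ e′ → ⌊ e′ F.≟ e ⌋) α) (push-merge-α (λ w → hingesAt 𝓖′ w e))

    -- Simplicity gives at most `suc p` hinges of `e` at `α`; the quotient is at most 1, hence so is
    -- its rounding.
    new≤1 : ∀ e → hingesAt 𝓖′ zero e ≤ 1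
    new≤1 e = N.s≤s⁻¹ (*-cancelʳ-< (suc p) _ 2 (<-≤-trans (Near.below (near-edge e))
      (≤-trans (+-monoˡ-≤ (suc p) (≤-trans (simple α e) (≤-reflexive gα)))
        (≤-reflexive (cong (suc p +_) (sym (+-identityʳ (suc p))))))))

    simple′ : SimpleFn 𝓖′ g′
    simple′ zero e = new≤1 e
    simple′ (suc v) e with v F.≟ α
    ... | no v≢α = ≤-trans (≤-reflexive (sym (≡.trans (degIn-merge (λ e′ → ⌊ e′ F.≟ e ⌋) v)
                     (push-merge-other (λ w → hingesAt 𝓖′ w e) v≢α)))) (simple v e)
    -- If no hinge of `e` moves, fairness shows that `e` had fewer than `suc p` hinges at `α`;
    -- otherwise at least one of at most `suc p` is gone.
    ... | yes ≡.refl = N.s≤s⁻¹ (small (hingesAt 𝓖′ zero e) (hingesAt-α e) (near-edge e)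
                         (≤-trans (simple α e) (≤-reflexive gα)))
      where
      small : ∀ x {y a} → a ≡ x + y → Near x a (suc p) → a ≤ suc p → y < suc p
      small zero ≡.refl (bounds lt _) _ = <-≤-trans lt (≤-reflexive (+-identityʳ (suc p)))
      small (suc x) {y} ≡.refl _ le = ≤-trans (s≤s (m≤n+m y x)) le

    -- Amalgamation maps compose, and `Near-trans` joins the rounding of this split to that of the
    -- later ones.
    compose : (∀ u → 1 ≤ g u) → FairDetachment 𝓖′ f g′ → FairDetachment 𝓖 f g
    compose pos D = record
      { n = D.n ; Ψ = λ w → merge (D.Ψ w) ; ψG = D.ψG
      ; commutes = λ h → ≡.trans (cong merge (D.commutes h)) (merge-ψ′ h)
      ; number = number
      ; simple = D.simple
      ; degrees = λ c w → degree c (D.Ψ w) (D.degrees c w)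
      ; mults = λ c μ μ≤1 → subst₂ (Near _)
          (multIn-cong 𝓖 (select f c) (push-∘ D.Ψ merge μ))
          (prodFin-cong nᵥ (λ u → cong (g u C_) (push-∘ D.Ψ merge μ u)))
          (multiplicity c (push D.Ψ μ) (λ w → ≤-trans (push-mono D.Ψ μ≤1 w) (≤-reflexive (D.number w)))
            (D.mults c μ μ≤1))
      }
      where
      module D = FairDetachment D

      number : ∀ u → numberFn (λ w → merge (D.Ψ w)) u ≡ g u
      number u = begin
        push (λ w → merge (D.Ψ w)) (λ _ → 1) u ≡⟨ push-∘ D.Ψ merge (λ _ → 1) u ⟨
        push merge (numberFn D.Ψ) u            ≡⟨ push-cong merge D.number u ⟩
        push merge g′ u                        ≡⟨ total u ⟩
        g u                                    ∎
        where
        open ≡.≡-Reasoning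
        total : ∀ u → push merge g′ u ≡ g u
        total u with u F.≟ α
        ... | yes ≡.refl = ≡.trans (push-merge-α g′) (≡.trans (cong suc g′-α) (sym gα))
        ... | no u≢α = ≡.trans (push-merge-other g′ u≢α) (g′-other u≢α)

      -- The factor 1 brings the quotient into the shape that `Near-trans` and `Near-complement`
      -- expect.
      near-colour₁ : ∀ c → Near (degIn 𝓖′ (select f c) zero) (degIn 𝓖 (select f c) α * 1) (suc p)
      near-colour₁ c = subst (λ y → Near (degIn 𝓖′ (select f c) zero) y (suc p))
        (sym (*-identityʳ (degIn 𝓖 (select f c) α))) (near-colour c)

      degree : ∀ c v {x} → Near x (degIn 𝓖′ (select f c) v) (g′ v) →
        Near x (degIn 𝓖 (select f c) (merge v)) (g (merge v))
      degree c zero near = Near-trans {s = 1} {p = suc p} (s≤s z≤n)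
        (≡.trans (*-identityˡ (suc p)) (≡.trans (sym gα) (sym (*-identityʳ (g α)))))
        (near-colour₁ c) near
      degree c (suc v) {x} near with v F.≟ α
      ... | no v≢α = subst (λ y → Near x y (g v))
              (sym (≡.trans (degIn-merge (select f c) v) (push-merge-other (degIn 𝓖′ (select f c)) v≢α))) near
      -- `α` keeps the complement of a `1 / suc p` share of its degree, a share of `p / suc p`.
      ... | yes ≡.refl = Near-trans {s = p} {p = suc p} p>0
              (≡.trans (*-comm p (suc p)) (cong (_* p) (sym gα)))
              (Near-complement {i = 1} {s = p}
                (sym (≡.trans (degIn-merge (select f c) α) (push-merge-α (degIn 𝓖′ (select f c))))) ≡.refl
                (near-colour₁ c))
              near

      -- Only the factor at `α` changes, since the factor of the new vertex is `1 C 0` or `1 C 1`.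
      binomials-split : ∀ (μ : Fin (suc nᵥ) → ℕ) s → μ zero ≤ 1 →
        (p C μ (suc α)) * suc p ≡ (suc p C push merge μ α) * s →
        binomials g′ μ * suc p ≡ binomials g (push merge μ) * s
      binomials-split μ s μ₀≤1 eq
        rewrite 1C≤1 μ₀≤1 | +-identityʳ (prodFin nᵥ (λ v → g′ (suc v) C μ (suc v))) =
        prodFin-change nᵥ α
          (λ v v≢α → cong₂ _C_ (g′-other v≢α) (sym (push-merge-other μ v≢α)))
          (≡.trans (cong (λ q → (q C μ (suc α)) * suc p) g′-α)
            (≡.trans eq (cong (λ q → (q C push merge μ α) * s) (sym gα))))

      multiplicity : ∀ c (μ : Fin (suc nᵥ) → ℕ) → (∀ w → μ w ≤ g′ w) → ∀ {x} →
        Near x (multIn 𝓖′ (select f c) μ) (binomials g′ μ) →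
        Near x (multIn 𝓖 (select f c) (push merge μ)) (binomials g (push merge μ))
      multiplicity c μ μ≤g′ {x} near = cases (μ zero) ≡.refl (μ≤g′ zero)
        where
        cases : ∀ m → μ zero ≡ m → m ≤ 1 →
          Near x (multIn 𝓖 (select f c) (push merge μ)) (binomials g (push merge μ))
        -- The new vertex is not in `μ`. The scale is `suc p - μ (suc α)`; as `μ (suc α) ≤ p`, it
        -- can be written as a successor and is positive.
        cases zero μ₀ _ = Near-trans {s = suc (p ∸ μ (suc α))} (s≤s z≤n)
          (binomials-split μ _ (≤-trans (≤-reflexive μ₀) z≤n)
            (≡.trans (C-absorb′ p (μ (suc α)) _ sum≡)
              (cong (λ i → (suc p C i) * suc (p ∸ μ (suc α))) (sym total))))
          (near-mult-0 new≤1 c μ _ μ₀ (≡.trans (cong (_+ suc (p ∸ μ (suc α))) total) sum≡)) near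
          where
          total : push merge μ α ≡ μ (suc α)
          total = ≡.trans (push-merge-α μ) (cong (_+ μ (suc α)) μ₀)
          sum≡ : μ (suc α) + suc (p ∸ μ (suc α)) ≡ suc p
          sum≡ = ≡.trans (+-suc (μ (suc α)) _)
            (cong suc (m+[n∸m]≡n (≤-trans (μ≤g′ (suc α)) (≤-reflexive g′-α))))
        -- The new vertex is in `μ`. The scale is the multiplicity of `α` below, which is positive
        -- because the new vertex contributes to it.
        cases (suc zero) μ₀ _ = Near-trans {s = push merge μ α}
          (subst (0 <_) (sym total) (s≤s z≤n))
          (binomials-split μ _ (≤-reflexive μ₀)
            (≡.trans (sym (C-absorb p (μ (suc α)))) (cong (λ i → (suc p C i) * i) (sym total))))
          (near-mult-1 new≤1 c μ μ₀) near
          where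
          total : push merge μ α ≡ suc (μ (suc α))
          total = ≡.trans (push-merge-α μ) (cong (_+ μ (suc α)) μ₀)
        cases (suc (suc _)) _ (s≤s ())

-- Induction on the number of splits.

undetached : (𝓖 : Hypergraph) {k : ℕ} (f : Fin (nE 𝓖) → Fin k) (g : Fin (nV 𝓖) → ℕ) →
  (∀ v → g v ≡ 1) → SimpleFn 𝓖 g → FairDetachment 𝓖 f g
undetached 𝓖 f g g≡1 simple = record
  { n = nV 𝓖 ; Ψ = λ v → v ; ψG = ψ 𝓖
  ; commutes = λ _ → ≡.refl
  ; number = λ u → ≡.trans (push-id (λ _ → 1) u) (sym (g≡1 u))
  ; simple = λ v e → ≤-trans (simple v e) (≤-reflexive (g≡1 v))
  ; degrees = λ c v → subst (Near _ _) (sym (g≡1 v)) (Near-refl _)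
  ; mults = λ c μ μ≤1 → subst₂ (Near _)
      (multIn-cong 𝓖 (select f c) (λ v → sym (push-id μ v)))
      (sym (prodFin-one (nV 𝓖) (λ v → ≡.trans (cong₂ _C_ (g≡1 v) (push-id μ v)) (1C≤1 (μ≤1 v)))))
      (Near-refl _)
  }

-- The sum of all `g v - 1` is the number of splits still to be made. When it is 0 every quotient
-- has denominator 1 and `𝓖` itself serves.
fairDetachment : (𝓖 : Hypergraph) {k : ℕ} (f : Fin (nE 𝓖) → Fin k) (g : Fin (nV 𝓖) → ℕ) →
  (∀ u → 1 ≤ g u) → SimpleFn 𝓖 g → FairDetachment 𝓖 f g
fairDetachment 𝓖 f g = go (suc (sumFin (nV 𝓖) (λ v → g v ∸ 1))) 𝓖 f g ≤-refl
  where
  go : ∀ fuel (𝓖 : Hypergraph) {k} (f : Fin (nE 𝓖) → Fin k) g →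
    sumFin (nV 𝓖) (λ v → g v ∸ 1) < fuel → (∀ u → 1 ≤ g u) → SimpleFn 𝓖 g → FairDetachment 𝓖 f g
  go (suc fuel) 𝓖 f g (s≤s le) pos simple with Fₚ.any? (λ v → 2 ≤? g v)
  ... | no none = undetached 𝓖 f g (λ v → ≤-antisym (N.s≤s⁻¹ (≰⇒> (λ 2≤ → none (v , 2≤)))) (pos v)) simple
  ... | yes (α , 2≤gα) = compose g gα p>0 simple pos
          (go fuel 𝓖′ f (g′ g gα p>0 simple) (<-≤-trans (g′-decreases g gα p>0 simple) le)
            (g′-positive g gα p>0 simple pos) (simple′ g gα p>0 simple))
    where
    open Split 𝓖 f α (g α ∸ 1)
    gα : g α ≡ suc (g α ∸ 1)
    gα = sym (m+[n∸m]≡n (pos α))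
    p>0 : 0 < g α ∸ 1
    p>0 = ∸-monoˡ-≤ 1 2≤gα

-- Floor and ceiling of a fraction.

-- The floor times the denominator is at most the numerator, hence less than `suc x` times the
-- denominator, which cancels.
floor-≤ : ∀ q x → ℚ.↥ q ℤ.< ℤ.suc x ℤ.* ℚ.↧ q → ℚ.floor q ℤ.≤ x
floor-≤ q@record{} x lt = subst (ℚ.floor q ℤ.≤_) (ℤₚ.pred-suc x) (ℤₚ.i<j⇒i≤pred[j] {j = ℤ.suc x}
  (ℤₚ.*-cancelʳ-<-nonNeg (ℚ.↧ q) (ℤₚ.≤-<-trans ([n/d]*d≤n (ℚ.↥ q) (ℚ.↧ q)) lt)))

-- The ceiling of `q` is minus the floor of `- q`, so this is the floor bound for `- q` and `- x`.
≤-ceiling : ∀ q x → x ℤ.* ℚ.↧ q ℤ.< ℚ.↥ q ℤ.+ ℚ.↧ q → x ℤ.≤ ℚ.ceiling q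
≤-ceiling q@record{} x lt = subst (ℤ._≤ ℚ.ceiling q) (ℤₚ.neg-involutive x)
  (ℤₚ.neg-mono-≤ (floor-≤ (ℚ.- q) (ℤ.- x) (subst₂ (λ n d → n ℤ.< ℤ.suc (ℤ.- x) ℤ.* d)
    (sym (ℚₚ.↥-neg q)) (sym (ℚₚ.↧-neg q))
    (subst₂ ℤ._<_ (lhs x (ℚ.↥ q) (ℚ.↧ q)) (rhs x (ℚ.↥ q) (ℚ.↧ q))
      (ℤₚ.+-monoʳ-< (ℤ.- (ℚ.↥ q) ℤ.- x ℤ.* ℚ.↧ q) lt)))))
  where
  lhs : ∀ x n d → (ℤ.- n ℤ.- x ℤ.* d) ℤ.+ x ℤ.* d ≡ ℤ.- n
  lhs = ℤ-solve-∀
  rhs : ∀ x n d → (ℤ.- n ℤ.- x ℤ.* d) ℤ.+ (n ℤ.+ d) ≡ (ℤ.1ℤ ℤ.+ (ℤ.- x)) ℤ.* d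
  rhs = ℤ-solve-∀

-- The rational is kept in lowest terms; `a` and `b` are its numerator and denominator times their
-- gcd `G`, which cancels from both bounds.
Near⇒≈ : ∀ {x a b} → Near x a b → x ≈ a / b
Near⇒≈ {x} {a} {b} (bounds above below) nz =
  floor-≤ q (ℤ.+ x) (ℤₚ.*-cancelʳ-<-nonNeg G (subst₂ ℤ._<_ (sym N*G) scaled (ℤ.+<+ above))) ,
  ≤-ceiling q (ℤ.+ x) (ℤₚ.*-cancelʳ-<-nonNeg G (subst₂ ℤ._<_ scaled′ total (ℤ.+<+ below)))
  where
  q = ℚ._/_ (ℤ.+ a) b {{nz}}
  G = ℤGCD.gcd (ℤ.+ a) (ℤ.+ b)
  N*G : ℚ.↥ q ℤ.* G ≡ ℤ.+ a
  N*G = ℚₚ.↥-/ (ℤ.+ a) b {{nz}}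
  D*G : ℚ.↧ q ℤ.* G ≡ ℤ.+ b
  D*G = ℚₚ.↧-/ (ℤ.+ a) b {{nz}}
  scale : ∀ y → ℤ.+ (y * b) ≡ ℤ.+ y ℤ.* ℚ.↧ q ℤ.* G
  scale y = ≡.trans (ℤₚ.pos-* y b)
    (≡.trans (cong (ℤ.+ y ℤ.*_) (sym D*G)) (sym (ℤₚ.*-assoc (ℤ.+ y) (ℚ.↧ q) G)))
  scaled = scale (suc x)
  scaled′ = scale x
  total : ℤ.+ (a + b) ≡ (ℚ.↥ q ℤ.+ ℚ.↧ q) ℤ.* G
  total = sym (≡.trans (ℤₚ.*-distribʳ-+ G (ℚ.↥ q) (ℚ.↧ q)) (cong₂ ℤ._+_ N*G D*G))

-- Families of sets of new vertices as multisets.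

countFin-∣∣ : ∀ {n} (U : Subset n) → countFin n (λ w → ⌊ w ∈? U ⌋) ≡ ∣ U ∣
countFin-∣∣ [] = ≡.refl
countFin-∣∣ {suc n} (inside ∷ U) = cong suc (≡.trans (countFin-cong n λ w →
  ⌊⌋-cong (suc w ∈? inside ∷ U) (w ∈? U) drop-there there) (countFin-∣∣ U))
countFin-∣∣ {suc n} (outside ∷ U) = ≡.trans (countFin-cong n λ w →
  ⌊⌋-cong (suc w ∈? outside ∷ U) (w ∈? U) drop-there there) (countFin-∣∣ U)

countFin-≤1 : ∀ n {P : Fin n → Set} (P? : ∀ i → Dec (P i)) →
  (∀ i j → P i → P j → i ≡ j) → countFin n (λ i → ⌊ P? i ⌋) ≤ 1
countFin-≤1 zero P? unique = z≤n
countFin-≤1 (suc n) P? unique with P? zero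
... | yes p₀ = ≤-reflexive (cong suc (sumFin-zero n λ i → cong 𝟙
                 (⌊⌋-false (P? (suc i)) (λ pᵢ → case unique zero (suc i) p₀ pᵢ of λ ()))))
... | no _ = countFin-≤1 n (λ i → P? (suc i))
               (λ i j pᵢ pⱼ → Fₚ.suc-injective (unique (suc i) (suc j) pᵢ pⱼ))

module _ {n m r : ℕ} (Ψ : Fin n → Fin m) (us : Fin r → Fin m)
         (us-injective : ∀ i j → us i ≡ us j → i ≡ j)
         (U : Fin r → Subset n) (U⊆ : ∀ i w → w ∈ U i → Ψ w ≡ us i) where

  -- The sets lie over distinct vertices, hence are disjoint.
  unionMultiset-≤1 : ∀ w → unionMultiset r U w ≤ 1
  unionMultiset-≤1 w = countFin-≤1 r (λ i → w ∈? U i)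
    (λ i j wi wj → us-injective i j (≡.trans (sym (U⊆ i w wi)) (U⊆ j w wj)))

  push-unionMultiset : push Ψ (unionMultiset r U) ≗ powMultiset r us (λ i → ∣ U i ∣)
  push-unionMultiset u = begin
    sumFin n (λ w → if ⌊ Ψ w F.≟ u ⌋ then unionMultiset r U w else 0)
      ≡⟨ sumFin-cong n (λ w → sumFin-if r ⌊ Ψ w F.≟ u ⌋ _) ⟩
    sumFin n (λ w → sumFin r (λ i → if ⌊ Ψ w F.≟ u ⌋ then 𝟙 ⌊ w ∈? U i ⌋ else 0))
      ≡⟨ sumFin-swap n r _ ⟩
    sumFin r (λ i → sumFin n (λ w → if ⌊ Ψ w F.≟ u ⌋ then 𝟙 ⌊ w ∈? U i ⌋ else 0))
      -- All of `U i` lies over `us i`, so the condition on `Ψ w` becomes one on `i` and leaves the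
      -- inner sum.
      ≡⟨ sumFin-cong r (λ i → sumFin-cong n (inFibre i)) ⟩
    sumFin r (λ i → sumFin n (λ w → if ⌊ us i F.≟ u ⌋ then 𝟙 ⌊ w ∈? U i ⌋ else 0))
      ≡⟨ sumFin-cong r (λ i → sumFin-if n ⌊ us i F.≟ u ⌋ _) ⟨
    sumFin r (λ i → if ⌊ us i F.≟ u ⌋ then countFin n (λ w → ⌊ w ∈? U i ⌋) else 0)
      ≡⟨ sumFin-cong r (λ i → cong (λ s → if ⌊ us i F.≟ u ⌋ then s else 0) (countFin-∣∣ (U i))) ⟩
    powMultiset r us (λ i → ∣ U i ∣) u ∎
    where
    open ≡.≡-Reasoning
    if-0 : ∀ b c → (if b then 0 else 0) ≡ (if c then 0 else 0)
    if-0 true  true  = ≡.refl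
    if-0 true  false = ≡.refl
    if-0 false true  = ≡.refl
    if-0 false false = ≡.refl
    inFibre : ∀ i w → (if ⌊ Ψ w F.≟ u ⌋ then 𝟙 ⌊ w ∈? U i ⌋ else 0)
                    ≡ (if ⌊ us i F.≟ u ⌋ then 𝟙 ⌊ w ∈? U i ⌋ else 0)
    inFibre i w with w ∈? U i
    ... | yes w∈ = cong (λ v → if ⌊ v F.≟ u ⌋ then 1 else 0) (U⊆ i w w∈)
    ... | no _   = if-0 ⌊ Ψ w F.≟ u ⌋ ⌊ us i F.≟ u ⌋

-- The points are added one at a time: by injectivity the first one is absent from `later`, where
-- its factor is 1, and adding it multiplies the product by its own binomial coefficient.
binomials-powMultiset : ∀ {m} r (g : Fin m → ℕ) (us : Fin r → Fin m) →
  (∀ i j → us i ≡ us j → i ≡ j) → (ms : Fin r → ℕ) →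
  binomials g (powMultiset r us ms) ≡ prodFin r (λ i → g (us i) C ms i)
binomials-powMultiset {m} zero g us injective ms = prodFin-one m (λ _ → ≡.refl)
binomials-powMultiset {m} (suc r) g us injective ms = begin
  binomials g (powMultiset (suc r) us ms)
    ≡⟨ *-identityʳ _ ⟨
  binomials g (powMultiset (suc r) us ms) * 1
    ≡⟨ prodFin-change m (us zero) {1} {g (us zero) C ms zero} other own ⟩
  binomials g later * (g (us zero) C ms zero)
    ≡⟨ *-comm (binomials g later) _ ⟩
  (g (us zero) C ms zero) * binomials g later
    ≡⟨ cong ((g (us zero) C ms zero) *_) (binomials-powMultiset r g (λ i → us (suc i))
         (λ i j eq → Fₚ.suc-injective (injective (suc i) (suc j) eq)) (λ i → ms (suc i))) ⟩
  prodFin (suc r) (λ i → g (us i) C ms i) ∎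
  where
  open ≡.≡-Reasoning
  later : Fin m → ℕ
  later = powMultiset r (λ i → us (suc i)) (λ i → ms (suc i))
  later₀ : later (us zero) ≡ 0
  later₀ = sumFin-zero r λ i → cong (λ b → if b then ms (suc i) else 0)
    (⌊⌋-false (us (suc i) F.≟ us zero) (λ eq → case injective (suc i) zero eq of λ ()))
  other : ∀ v → v ≢ us zero → (g v C powMultiset (suc r) us ms v) ≡ (g v C later v)
  other v v≢ = cong (λ b → g v C ((if b then ms zero else 0) + later v))
    (⌊⌋-false (us zero F.≟ v) (≢-sym v≢))
  own : (g (us zero) C powMultiset (suc r) us ms (us zero)) * 1
      ≡ (g (us zero) C later (us zero)) * (g (us zero) C ms zero)
  own rewrite later₀ | ⌊⌋-true (us zero F.≟ us zero) ≡.refl | +-identityʳ (ms zero) =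
    *-comm (g (us zero) C ms zero) 1

numberFn-onto : ∀ {n m} (Ψ : Fin n → Fin m) u → 1 ≤ numberFn Ψ u → ∃ λ w → Ψ w ≡ u
numberFn-onto {n} Ψ u pos with Fₚ.any? (λ w → Ψ w F.≟ u)
... | yes found = found
... | no none = contradiction (≤-trans pos (≤-reflexive (sumFin-zero n λ w →
                  cong 𝟙 (⌊⌋-false (Ψ w F.≟ u) (λ eq → none (w , eq)))))) 1+n≰n

theorem4p1 : (𝓕 : Hypergraph) (k : ℕ) (f : Fin (nE 𝓕) → Fin k)
    (g : Fin (nV 𝓕) → ℕ) → (∀ u → 1 ≤ g u) → SimpleFn 𝓕 g →
    Σ ℕ λ n → Σ (Fin n → Fin (nV 𝓕)) λ Ψ → Σ (Fin (nH 𝓕) → Fin n) λ ψG →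
    let 𝓖 = detachment 𝓕 n ψG in
    IsAmalgamationMap 𝓕 ψG Ψ
    × (∀ u → numberFn Ψ u ≡ g u)
    × SimpleHG 𝓖
    × (∀ u v → Ψ v ≡ u → deg 𝓖 v ≈ deg 𝓕 u / g u)
    × (∀ u v j → Ψ v ≡ u →
    degIn 𝓖 (colourClass 𝓖 f j) v ≈ degIn 𝓕 (colourClass 𝓕 f j) u / g u)
    × (∀ (r : ℕ) (us : Fin r → Fin (nV 𝓕)) → (∀ i i′ → us i ≡ us i′ → i ≡ i′) →
    (U : Fin r → Subset n) → (∀ i w → w ∈ U i → Ψ w ≡ us i) →
    (∀ i → ∣ U i ∣ ≤ g (us i)) →
    mult 𝓖 (unionMultiset r U)
    ≈ mult 𝓕 (powMultiset r us (λ i → ∣ U i ∣))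
    / prodFin r (λ i → g (us i) C ∣ U i ∣))
    × (∀ (r : ℕ) (us : Fin r → Fin (nV 𝓕)) → (∀ i i′ → us i ≡ us i′ → i ≡ i′) →
    (U : Fin r → Subset n) → (∀ i w → w ∈ U i → Ψ w ≡ us i) →
    (∀ i → ∣ U i ∣ ≤ g (us i)) → (j : Fin k) →
    multIn 𝓖 (colourClass 𝓖 f j) (unionMultiset r U)
    ≈ multIn 𝓕 (colourClass 𝓕 f j) (powMultiset r us (λ i → ∣ U i ∣))
    / prodFin r (λ i → g (us i) C ∣ U i ∣))
theorem4p1 𝓕 k f g pos simpleF =
  n , Ψ , ψG ,
  ((λ u → numberFn-onto Ψ u (≤-trans (pos u) (≤-reflexive (sym (number u))))) , commutes) ,
  number , simple ,
  -- By unfolding, `select f nothing` and `select f (just j)` are `allEdges` and the class of colour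
  -- `j`.
  (λ { u v ≡.refl → Near⇒≈ (degrees nothing v) }) ,
  (λ { u v j ≡.refl → Near⇒≈ (degrees (just j) v) }) ,
  (λ r us inj U U⊆ _ → multiplicity nothing r us inj U U⊆) ,
  (λ r us inj U U⊆ _ j → multiplicity (just j) r us inj U U⊆)
  where
  D = fairDetachment 𝓕 f g pos simpleF
  open FairDetachment D
  multiplicity : ∀ c r us → (∀ i i′ → us i ≡ us i′ → i ≡ i′) → (U : Fin r → Subset n) →
    (∀ i w → w ∈ U i → Ψ w ≡ us i) →
    multIn (detachment 𝓕 n ψG) (select f c) (unionMultiset r U)
    ≈ multIn 𝓕 (select f c) (powMultiset r us (λ i → ∣ U i ∣))
    / prodFin r (λ i → g (us i) C ∣ U i ∣)
  multiplicity c r us inj U U⊆ = Near⇒≈ (subst₂ (Near _)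
    (multIn-cong 𝓕 (select f c) push≗)
    (≡.trans (prodFin-cong (nV 𝓕) (λ u → cong (g u C_) (push≗ u)))
      (binomials-powMultiset r g us inj (λ i → ∣ U i ∣)))
    (mults c (unionMultiset r U) (unionMultiset-≤1 Ψ us inj U U⊆)))
    where
    push≗ : push Ψ (unionMultiset r U) ≗ powMultiset r us (λ i → ∣ U i ∣)
    push≗ = push-unionMultiset Ψ us inj U U⊆
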